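{- There is an algorithm that, given a graph $G$ with neighbourhood diversity $nd(G)=k$, computes ${\rm I}_v(G)$ in time $f(k)\cdot |V(G)|^{\mathcal{O}(1)}$ for some computable function $f$ (i.e., the problem is FPT parameterised by neighbourhood diversity).
   Context: Two vertices $u,v$ are twins if $N(u)\setminus\{v\}=N(v)\setminus\{u\}$; being twins is an equivalence relation, and the neighbourhood diversity $nd(G)$ is the number of its equivalence classes. A graph is locally irregular if no two adjacent vertices have the same degree. A vertex-irregulator of $G=(V,E)$ is a set $S\subseteq V$ such that $G[V\setminus S]$ is locally irregular; ${\rm I}_v(G)$ denotes the minimum cardinality of a vertex-irregulator. -}

module Defs where

open import Data.Bool using (Bool; true; false; if_then_else_)
open import Data.Fin using (Fin; fromℕ<; remQuot)
open import Data.Fin.Subset using (Subset; _∈_; _∩_; _-_; ∁; ∣_∣)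
open import Data.Nat using (ℕ; suc; _+_; _*_; _∸_; _≤_; _≡ᵇ_; _<?_)
open import Data.Product using (_×_; _,_; ∃-syntax)
open import Data.Vec using (tabulate)
open import Function.Bundles using (_⇔_)
open import Function.Definitions using (Surjective)
open import Relation.Binary.PropositionalEquality using (_≡_; _≢_)
open import Relation.Nullary using (yes; no)

record Graph (n : ℕ) : Set where
  field
    adj    : Fin n → Fin n → Bool
    sym    : ∀ u v → adj u v ≡ adj v u
    irrefl : ∀ v → adj v v ≡ false

open Graph public using (adj)

N : ∀ {n} → Graph n → Fin n → Subset n
N G v = tabulate (adj G v)

Twins : ∀ {n} → Graph n → Fin n → Fin n → Set
Twins G u v = N G u - v ≡ N G v - u

-- nd(G) = k: the quotient of the vertex set by the twin relation, with
-- quotient map classOf, has exactly k elements.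
record NeighbourhoodDiversity {n : ℕ} (G : Graph n) (k : ℕ) : Set where
  field
    classOf    : Fin n → Fin k
    surjective : Surjective _≡_ _≡_ classOf
    sameClass  : ∀ u v → classOf u ≡ classOf v ⇔ Twins G u v

-- The degree of v in the induced subgraph G[W], for v ∈ W.
degreeIn : ∀ {n} → Graph n → Subset n → Fin n → ℕ
degreeIn G W v = ∣ N G v ∩ W ∣

-- The induced subgraph G[W] is locally irregular.
LocallyIrregularOn : ∀ {n} → Graph n → Subset n → Set
LocallyIrregularOn G W =
  ∀ u v → u ∈ W → v ∈ W → adj G u v ≡ true → degreeIn G W u ≢ degreeIn G W v

VertexIrregulator : ∀ {n} → Graph n → Subset n → Set
VertexIrregulator G S = LocallyIrregularOn G (∁ S)

-- I_v(G) = m.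
MinVertexIrregulator : ∀ {n} → Graph n → ℕ → Set
MinVertexIrregulator {n} G m =
  (∃[ S ] VertexIrregulator G S × ∣ S ∣ ≡ m) ×
  (∀ (S : Subset n) → VertexIrregulator G S → m ≤ ∣ S ∣)

-- Algorithms are structured programs for a random access machine with
-- registers and an unbounded memory, both holding natural numbers. The
-- arithmetic primitives are addition and truncated subtraction only: with
-- these, unit-cost time is polynomially related to Turing machine time
-- (which would fail if multiplication had unit cost).

data Expr : Set where
  lit     : ℕ → Expr
  reg     : ℕ → Expr
  load    : Expr → Expr
  _⊕_ _⊖_ : Expr → Expr → Expr

data Program : Set where
  skip            : Program
  _≔_             : ℕ → Expr → Program
  store           : (address value : Expr) → Program
  _⨟_             : Program → Program → Program
  ifNZ_then_else_ : Expr → Program → Program → Program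
  whileNZ_loop_   : Expr → Program → Program

infixl 6 _⊕_ _⊖_
infix  5 _≔_
infix  4 ifNZ_then_else_ whileNZ_loop_
infixr 3 _⨟_

record State : Set where
  constructor ⟨_,_⟩
  field
    registers memory : ℕ → ℕ

open State public

_[_↦_] : (ℕ → ℕ) → ℕ → ℕ → (ℕ → ℕ)
(g [ x ↦ a ]) y = if y ≡ᵇ x then a else g y

eval : State → Expr → ℕ
eval s (lit a)   = a
eval s (reg x)   = registers s x
eval s (load e)  = memory s (eval s e)
eval s (e ⊕ e′)  = eval s e + eval s e′
eval s (e ⊖ e′)  = eval s e ∸ eval s e′

cost : Expr → ℕ
cost (lit _)   = 1
cost (reg _)   = 1
cost (load e)  = suc (cost e)
cost (e ⊕ e′)  = suc (cost e + cost e′)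
cost (e ⊖ e′)  = suc (cost e + cost e′)

-- p / s ⇓[ t ] s′: started in state s, the program p halts in state s′ after
-- exactly t steps.
infix 2 _/_⇓[_]_
data _/_⇓[_]_ : Program → State → ℕ → State → Set where
  ⇓skip : ∀ {s} → skip / s ⇓[ 1 ] s
  ⇓assign : ∀ {s x e} →
    (x ≔ e) / s ⇓[ suc (cost e) ] ⟨ registers s [ x ↦ eval s e ] , memory s ⟩
  ⇓store : ∀ {s a e} →
    store a e / s ⇓[ suc (cost a + cost e) ]
      ⟨ registers s , memory s [ eval s a ↦ eval s e ] ⟩
  ⇓seq : ∀ {s s′ s″ p q t t′} →
    p / s ⇓[ t ] s′ → q / s′ ⇓[ t′ ] s″ → (p ⨟ q) / s ⇓[ t + t′ ] s″
  ⇓then : ∀ {s s′ e p q t} → eval s e ≢ 0 →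
    p / s ⇓[ t ] s′ → (ifNZ e then p else q) / s ⇓[ suc (cost e + t) ] s′
  ⇓else : ∀ {s s′ e p q t} → eval s e ≡ 0 →
    q / s ⇓[ t ] s′ → (ifNZ e then p else q) / s ⇓[ suc (cost e + t) ] s′
  ⇓exit : ∀ {s e p} → eval s e ≡ 0 →
    (whileNZ e loop p) / s ⇓[ suc (cost e) ] s
  ⇓loop : ∀ {s s′ s″ e p t t′} → eval s e ≢ 0 →
    p / s ⇓[ t ] s′ → (whileNZ e loop p) / s′ ⇓[ t′ ] s″ →
    (whileNZ e loop p) / s ⇓[ suc (cost e + t + t′) ] s″

-- Results are returned in register 0.
_/_Returns_inTime_ : Program → State → ℕ → ℕ → Set
p / s Returns m inTime t = ∃[ s′ ] (p / s ⇓[ t ] s′) × registers s′ 0 ≡ m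

natInput : ℕ → State
natInput k = ⟨ (λ _ → 0) [ 0 ↦ k ] , (λ _ → 0) ⟩

-- The adjacency matrix stored row by row from address 0, zeros after it.
adjacencyMatrix : ∀ {n} → Graph n → ℕ → ℕ
adjacencyMatrix {n} G a with a <? n * n
... | no _  = 0
... | yes a<n*n with remQuot {n} n (fromℕ< a<n*n)
...   | u , v = if adj G u v then 1 else 0

-- The input is n = |V(G)| in register 0 and the adjacency matrix in memory.
graphInput : ∀ {n} → Graph n → State
graphInput {n} G = ⟨ (λ _ → 0) [ 0 ↦ n ] , adjacencyMatrix G ⟩

Computable : (ℕ → ℕ) → Set
Computable f = ∃[ p ] ∀ k → ∃[ t ] p / natInput k Returns f k inTime t

{-# OPTIONS --safe #-}

-- A locally irregular induced subgraph keeps at most one vertex of a twin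
-- class that is a clique, and whether it is locally irregular depends only on
-- the numbers X c of kept vertices per class c. For adjacent classes c, c′
-- the degrees are linear in X, and as functions of a single X c₀ they have
-- slopes 0 or 1. So once X c₀ ≥ 2, each of the k² pairs of classes forbids at
-- most one further value of X c₀, and X c₀ can be raised to one of the k² + 1
-- largest values that the class size s permits. Hence it suffices to try, in
-- each class, the values 0, 1 and s − j with j ≤ k²: these are (k² + 3)^k
-- candidates, each tested in polynomial time.
--
-- The candidates are numbered by t < (k² + 3)^k and decoded digit by digit, so
-- the machine never writes to its memory. The program can therefore be
-- compiled from expressions whose loops all run over the four quantities n, k,
-- k² + 3 and (k² + 3)^k, and whose running time is polynomial in their sum.
module Submission where

open import Data.Bool using (Bool; true; false; if_then_else_; not; _∧_)
import Data.Bool.Properties as Bool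
open import Data.Empty using (⊥)
open import Data.Fin using (Fin; toℕ; zero; suc; inject₁; fromℕ; fromℕ<; combine; remQuot)
import Data.Fin.Properties as Fin
open import Data.Fin.Relation.Unary.Top using (view; ‵fromℕ; ‵inject₁)
open import Data.Fin.Subset using (Subset; ∣_∣; ⊤; ∁; _∩_; _-_)
open import Data.Fin.Subset.Properties using (∣⊤∣≡n; ∈⊤; x∈∁p⇒x∉p; p─⊥≡p)
open import Data.List using (List; []; _∷_; allFin)
open import Data.List.Membership.Propositional using (_∈_)
open import Data.List.Membership.Propositional.Properties using (∈-allFin)
open import Data.List.Relation.Unary.Any using (here; there)
open import Data.Nat
open import Data.Nat.Properties
open import Data.Product using (_×_; _,_; proj₁; proj₂; ∃-syntax; Σ-syntax)
open import Data.Sum using (_⊎_; inj₁; inj₂; [_,_])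
open import Data.Vec using (Vec; []; _∷_; lookup; tabulate; _[_]≔_; sum)
open import Data.Vec.Properties using (lookup∘updateAt; lookup∘updateAt′; lookup∘tabulate; lookup-zipWith; lookup-map; []=⇒lookup; lookup⇒[]=; tabulate-cong; tabulate∘lookup)
open import Function using (_∘_; Equivalence)
open import Relation.Binary.Definitions using (tri<; tri≈; tri>)
open import Relation.Binary.PropositionalEquality hiding ([_])
open import Relation.Nullary using (Dec; yes; no; ¬_; does; contradiction; ¬?)
open import Relation.Nullary.Decidable using (_×-dec_; dec-true; dec-false; decidable-stable)
open import Relation.Unary using (Decidable)
open import Algebra.Properties.CommutativeMonoid.Sum +-0-commutativeMonoid using (∑-distrib-+; ∑-comm; sum-cong-≗; sum-replicate-zero) renaming (sum to ∑)
open import Defs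

-- Loop expressions and their compilation

-- The machine is given neither the parameter nor a numbering of the classes. It addresses a class
-- through its least vertex, recognised by comparing adjacencies, so `k` and the loop bounds derived
-- from it are computed along the way. Raising `X c₀` only shrinks the deleted set, so the exchange
-- never costs anything. It is confined to `X c₀ ≥ 2` for two reasons: such a class is not a clique,
-- and it is already inhabited, so raising it brings no new pair of classes into play. The exponent
-- of `n` must not depend on `k`. Since every loop ranges over a global, the degree of the running
-- time comes from the shape of the program alone. The globals sum to at most a function of `k`
-- times `n`, and a power of this product splits into the two factors wanted.

cond : ℕ → ℕ → ℕ → ℕ
cond zero    _ y = y
cond (suc _) x _ = x

-- The index descends because a compiled loop decrements its counter before it runs the body.
fold↓ : ℕ → (ℕ → ℕ → ℕ) → ℕ → ℕ
fold↓ zero    f z = z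
fold↓ (suc n) f z = fold↓ n f (f n z)

-- A loop ranges over a global, never over a computed value, so the globals alone bound the number
-- of rounds. Its body sees the index and the accumulator as two new variables.
data Exp (m : ℕ) : Set where
  con       : ℕ → Exp m
  var       : Fin m → Exp m
  glob      : Fin 4 → Exp m
  mem       : Exp m → Exp m
  _+ᵉ_ _∸ᵉ_ : Exp m → Exp m → Exp m
  condᵉ     : Exp m → Exp m → Exp m → Exp m
  loopᵉ     : Fin 4 → Exp m → Exp (2 + m) → Exp m
  letᵉ      : Exp m → Exp (1 + m) → Exp m

infixl 6 _+ᵉ_ _∸ᵉ_

⟦_⟧ : ∀ {m} → Exp m → (ℕ → ℕ) → Vec ℕ 4 → Vec ℕ m → ℕ
⟦ con c ⟧ μ γ ρ       = c
⟦ var x ⟧ μ γ ρ       = lookup ρ x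
⟦ glob g ⟧ μ γ ρ      = lookup γ g
⟦ mem e ⟧ μ γ ρ       = μ (⟦ e ⟧ μ γ ρ)
⟦ e +ᵉ e′ ⟧ μ γ ρ     = ⟦ e ⟧ μ γ ρ + ⟦ e′ ⟧ μ γ ρ
⟦ e ∸ᵉ e′ ⟧ μ γ ρ     = ⟦ e ⟧ μ γ ρ ∸ ⟦ e′ ⟧ μ γ ρ
⟦ condᵉ e x y ⟧ μ γ ρ = cond (⟦ e ⟧ μ γ ρ) (⟦ x ⟧ μ γ ρ) (⟦ y ⟧ μ γ ρ)
⟦ loopᵉ g e b ⟧ μ γ ρ =
  fold↓ (lookup γ g) (λ i a → ⟦ b ⟧ μ γ (i ∷ a ∷ ρ)) (⟦ e ⟧ μ γ ρ)
⟦ letᵉ e b ⟧ μ γ ρ    = ⟦ b ⟧ μ γ (⟦ e ⟧ μ γ ρ ∷ ρ)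

-- Variables live in the registers listed in w, globals in registers 0–3;
-- registers from d on are free, and the value ends up in register d.
compile : ∀ {m} → Vec ℕ m → ℕ → Exp m → Program
compile w d (con c)       = d ≔ lit c
compile w d (var x)       = d ≔ reg (lookup w x)
compile w d (glob g)      = d ≔ reg (toℕ g)
compile w d (mem e)       = compile w d e ⨟ d ≔ load (reg d)
compile w d (e +ᵉ e′)     =
  compile w d e ⨟ compile w (suc d) e′ ⨟ d ≔ reg d ⊕ reg (suc d)
compile w d (e ∸ᵉ e′)     =
  compile w d e ⨟ compile w (suc d) e′ ⨟ d ≔ reg d ⊖ reg (suc d)
compile w d (condᵉ e x y) =
  compile w d e ⨟ (ifNZ reg d then compile w d x else compile w d y)
compile w d (loopᵉ g e b) =
  compile w d e ⨟ suc d ≔ reg (toℕ g) ⨟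
  (whileNZ reg (suc d) loop
    (suc d ≔ reg (suc d) ⊖ lit 1 ⨟
     compile (suc d ∷ d ∷ w) (2 + d) b ⨟ d ≔ reg (2 + d)))
compile w d (letᵉ e b)    =
  compile w d e ⨟ compile (d ∷ w) (suc d) b ⨟ d ≔ reg (suc d)

-- `B` bounds every global; both branches of a conditional are charged. Besides its body, a round of
-- a loop costs 8: 2 for the test, 4 for the decrement, 2 for the copy.
time : ∀ {m} → Exp m → ℕ → ℕ
time (con c)       B = 2
time (var x)       B = 2
time (glob g)      B = 2
time (mem e)       B = time e B + 3
time (e +ᵉ e′)     B = time e B + (time e′ B + 4)
time (e ∸ᵉ e′)     B = time e B + (time e′ B + 4)
time (condᵉ e x y) B = time e B + (2 + (time x B + time y B))
time (loopᵉ g e b) B = time e B + (2 + (B * (8 + time b B) + 2))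
time (letᵉ e b)    B = time e B + (time b B + 2)

update-same : ∀ (g : ℕ → ℕ) x a → (g [ x ↦ a ]) x ≡ a
update-same g x a with x ≡ᵇ x | ≡⇒≡ᵇ x x refl
... | true | _ = refl

update-other : ∀ (g : ℕ → ℕ) {x y} a → y ≢ x → (g [ x ↦ a ]) y ≡ g y
update-other g {x} {y} a y≢x with y ≡ᵇ x | ≡ᵇ⇒≡ y x
... | true  | eq = contradiction (eq _) y≢x
... | false | _  = refl

-- Correctness and running time of compiled expressions

module Execution (μ : ℕ → ℕ) (γ : Vec ℕ 4) (B : ℕ) (γ≤B : ∀ g → lookup γ g ≤ B) where

  -- All globals and variables live below register `d`, so code that writes from `d` on destroys
  -- none of them.
  record Layout {m} (w : Vec ℕ m) (d : ℕ) (ρ : Vec ℕ m) (s : State) : Set where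
    field
      globals : ∀ g → registers s (toℕ g) ≡ lookup γ g
      locals  : ∀ x → registers s (lookup w x) ≡ lookup ρ x
      below   : ∀ x → lookup w x < d
      room    : 4 ≤ d
      heap    : memory s ≡ μ

  open Layout

  record Run (p : Program) (s : State) (d v t : ℕ) : Set where
    field
      final   : State
      steps   : ℕ
      halts   : p / s ⇓[ steps ] final
      fast    : steps ≤ t
      result  : registers final d ≡ v
      frame   : ∀ {y} → y < d → registers final y ≡ registers s y
      heap′   : memory final ≡ memory s

  open Run

  keep : ∀ {m w d e s s′} {ρ : Vec ℕ m} → Layout w d ρ s → d ≤ e →
    (∀ {y} → y < d → registers s′ y ≡ registers s y) → memory s′ ≡ memory s →
    Layout w e ρ s′
  keep L d≤e fr hp = record
    { globals = λ g → trans (fr (<-≤-trans (Fin.toℕ<n g) (room L))) (globals L g)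
    ; locals  = λ x → trans (fr (below L x)) (locals L x)
    ; below   = λ x → <-≤-trans (below L x) d≤e
    ; room    = ≤-trans (room L) d≤e
    ; heap    = trans hp (heap L)
    }

  push : ∀ {m w d s v} {ρ : Vec ℕ m} → Layout w d ρ s → registers s d ≡ v →
    Layout (d ∷ w) (suc d) (v ∷ ρ) s
  push L eq = record
    { globals = globals L
    ; locals  = λ { zero → eq ; (suc x) → locals L x }
    ; below   = λ { zero → n<1+n _ ; (suc x) → m<n⇒m<1+n (below L x) }
    ; room    = m≤n⇒m≤1+n (room L)
    ; heap    = heap L
    }

  assign : ∀ {s d v} e t → eval s e ≡ v → suc (cost e) ≤ t → Run (d ≔ e) s d v t
  assign {s} {d} e t eq c≤t = record
    { final  = _
    ; steps  = _
    ; halts  = ⇓assign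
    ; fast   = c≤t
    ; result = trans (update-same (registers s) d (eval s e)) eq
    ; frame  = λ y<d → update-other (registers s) (eval s e) (<⇒≢ y<d)
    ; heap′  = refl
    }

  sequence : ∀ {p q s d d′ v v′ t t′} (r : Run p s d′ v′ t) → d ≤ d′ →
    Run q (final r) d v t′ → Run (p ⨟ q) s d v (t + t′)
  sequence r d≤d′ r′ = record
    { final  = final r′
    ; steps  = _
    ; halts  = ⇓seq (halts r) (halts r′)
    ; fast   = +-mono-≤ (fast r) (fast r′)
    ; result = result r′
    ; frame  = λ y<d → trans (frame r′ y<d) (frame r (<-≤-trans y<d d≤d′))
    ; heap′  = trans (heap′ r′) (heap′ r)
    }

  after : ∀ {m w d e d′ v t p s} {ρ : Vec ℕ m} → Layout w d ρ s →
    (r : Run p s d′ v t) → d ≤ d′ → d ≤ e → Layout w e ρ (final r)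
  after L r d≤d′ d≤e = keep L d≤e (λ y<d → frame r (<-≤-trans y<d d≤d′)) (heap′ r)

  branch : ∀ {p q s d a x y t t′} → registers s d ≡ a →
    Run p s d x t → Run q s d y t′ →
    Run (ifNZ reg d then p else q) s d (cond a x y) (2 + (t + t′))
  branch {a = zero} eq r r′ = record
    { final  = final r′
    ; steps  = _
    ; halts  = ⇓else eq (halts r′)
    ; fast   = s≤s (s≤s (≤-trans (fast r′) (m≤n+m _ _)))
    ; result = result r′
    ; frame  = frame r′
    ; heap′  = heap′ r′
    }
  branch {a = suc _} eq r r′ = record
    { final  = final r
    ; steps  = _
    ; halts  = ⇓then (λ z → 1+n≢0 (trans (sym eq) z)) (halts r)
    ; fast   = s≤s (s≤s (≤-trans (fast r) (m≤m+n _ _)))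
    ; result = result r
    ; frame  = frame r
    ; heap′  = heap′ r
    }

  slower : ∀ {p s d v t t′} → t ≤ t′ → Run p s d v t → Run p s d v t′
  slower t≤t′ r = record
    { final = final r ; steps = steps r ; halts = halts r
    ; fast = ≤-trans (fast r) t≤t′ ; result = result r ; frame = frame r ; heap′ = heap′ r }

  run : ∀ {m w d} {ρ : Vec ℕ m} (e : Exp m) {s} → Layout w d ρ s →
    Run (compile w d e) s d (⟦ e ⟧ μ γ ρ) (time e B)

  -- The counter is an arbitrary `i` rather than a global, so that induction can follow it down to
  -- 0.
  iterate : ∀ {m w d} {ρ : Vec ℕ m} (b : Exp (2 + m)) i {a s} →
    Layout w d ρ s → registers s d ≡ a → registers s (suc d) ≡ i →
    Run (whileNZ reg (suc d) loop
          (suc d ≔ reg (suc d) ⊖ lit 1 ⨟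
           compile (suc d ∷ d ∷ w) (2 + d) b ⨟ d ≔ reg (2 + d)))
        s d (fold↓ i (λ i a → ⟦ b ⟧ μ γ (i ∷ a ∷ ρ)) a) (i * (8 + time b B) + 2)

  run (con c) L  = assign _ _ refl ≤-refl
  run (var x) L  = assign _ _ (locals L x) ≤-refl
  run (glob g) L = assign _ _ (globals L g) ≤-refl
  run (mem e) L  =
    sequence r ≤-refl
      (assign _ _ (cong₂ (λ h x → h x) (heap (after L r ≤-refl ≤-refl)) (result r)) ≤-refl)
    where r = run e L
  run {d = d} (e +ᵉ e′) L =
    sequence r ≤-refl (sequence r′ (n≤1+n d)
      (assign _ _ (cong₂ _+_ (trans (frame r′ (n<1+n d)) (result r)) (result r′)) ≤-refl))
    where
    r  = run e L
    r′ = run e′ (after L r ≤-refl (n≤1+n d))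
  run {d = d} (e ∸ᵉ e′) L =
    sequence r ≤-refl (sequence r′ (n≤1+n d)
      (assign _ _ (cong₂ _∸_ (trans (frame r′ (n<1+n d)) (result r)) (result r′)) ≤-refl))
    where
    r  = run e L
    r′ = run e′ (after L r ≤-refl (n≤1+n d))
  run (condᵉ e x y) L =
    sequence r ≤-refl (branch (result r) (run x L′) (run y L′))
    where
    r  = run e L
    L′ = after L r ≤-refl ≤-refl
  run {d = d} (loopᵉ g e b) L =
    sequence r ≤-refl (sequence r′ (n≤1+n d)
      (slower (+-monoˡ-≤ 2 (*-monoˡ-≤ (8 + time b B) (γ≤B g)))
        (iterate b (lookup γ g) (after L′ r′ (n≤1+n d) ≤-refl)
          (trans (frame r′ (n<1+n d)) (result r)) (result r′))))
    where
    r  = run e L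
    L′ = after L r ≤-refl ≤-refl
    r′ = assign {final r} {suc d} (reg (toℕ g)) 2 (globals L′ g) ≤-refl
  run {d = d} (letᵉ e b) L =
    sequence r ≤-refl (sequence r′ (n≤1+n d) (assign _ _ (result r′) ≤-refl))
    where
    r  = run e L
    r′ = run b (push (after L r ≤-refl ≤-refl) (result r))

  iterate b zero {s = s} L ra ri = record
    { final = s ; steps = 2 ; halts = ⇓exit ri ; fast = ≤-refl
    ; result = ra ; frame = λ _ → refl ; heap′ = refl }
  iterate {w = w} {d} {ρ} b (suc i) {a} {s} L ra ri = record
    { final  = final rest
    ; steps  = _
    ; halts  = ⇓loop (λ z → 1+n≢0 (trans (sym ri) z)) (halts body) (halts rest)
    ; fast   = begin
        2 + (steps body + steps rest)
          ≤⟨ +-monoʳ-≤ 2 (+-mono-≤ (fast body) (fast rest)) ⟩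
        2 + (4 + (time b B + 2) + (i * (8 + time b B) + 2))
          ≡⟨ cong (λ z → 6 + (z + (i * (8 + time b B) + 2))) (+-comm (time b B) 2) ⟩
        8 + time b B + (i * (8 + time b B) + 2)
          ≡⟨ +-assoc (8 + time b B) _ 2 ⟨
        suc i * (8 + time b B) + 2 ∎
    ; result = result rest
    ; frame  = λ y<d → trans (frame rest y<d) (frame body y<d)
    ; heap′  = trans (heap′ rest) (heap′ body)
    }
    where
    open ≤-Reasoning
    r₁ : Run (suc d ≔ reg (suc d) ⊖ lit 1) s (suc d) i 4
    r₁ = assign _ _ (cong pred ri) ≤-refl
    L₁ = push (push (after L r₁ (n≤1+n d) ≤-refl) (trans (frame r₁ (n<1+n d)) ra)) (result r₁)
    r₂ = run b L₁
    r₃ : Run (d ≔ reg (2 + d)) (final r₂) d (⟦ b ⟧ μ γ (i ∷ a ∷ ρ)) 2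
    r₃ = assign _ _ (result r₂) ≤-refl
    body = sequence r₁ (n≤1+n d) (sequence r₂ (m≤n+m d 2) r₃)
    -- The body works above the counter register `suc d`, and the final copy writes only `d`, so the
    -- counter still holds `i`.
    rest = iterate {w = w} {d} {ρ} b i (after L body ≤-refl ≤-refl) (result body)
      (trans (update-other (registers (final r₂)) {d} _ 1+n≢n) (trans (frame r₂ (n<1+n (suc d))) (result r₁)))

-- Sequences of assignments to the globals

Script : Set
Script = List (Fin 4 × Exp 0)

-- A value computed at one stage becomes available as a loop range at the next.
⟪_⟫ : Script → (ℕ → ℕ) → Vec ℕ 4 → Vec ℕ 4
⟪ [] ⟫ μ γ          = γ
⟪ (g , e) ∷ l ⟫ μ γ = ⟪ l ⟫ μ (γ [ g ]≔ ⟦ e ⟧ μ γ [])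

compileScript : Script → Program
compileScript []            = skip
compileScript ((g , e) ∷ l) = compile [] 4 e ⨟ toℕ g ≔ reg 4 ⨟ compileScript l

scriptTime : Script → (ℕ → ℕ) → Vec ℕ 4 → ℕ
scriptTime [] μ γ            = 1
scriptTime ((g , e) ∷ l) μ γ =
  time e (sum γ) + (2 + scriptTime l μ (γ [ g ]≔ ⟦ e ⟧ μ γ []))

lookup≤sum : ∀ {m} (γ : Vec ℕ m) g → lookup γ g ≤ sum γ
lookup≤sum (x ∷ γ) zero    = m≤m+n x _
lookup≤sum (x ∷ γ) (suc g) = ≤-trans (lookup≤sum γ g) (m≤n+m _ x)

runScript : ∀ l μ γ {s} → (∀ g → registers s (toℕ g) ≡ lookup γ g) → memory s ≡ μ →
  ∃[ t ] (compileScript l / s Returns lookup (⟪ l ⟫ μ γ) zero inTime t) × t ≤ scriptTime l μ γ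
runScript [] μ γ G H = 1 , (_ , ⇓skip , G zero) , ≤-refl
runScript ((g , e) ∷ l) μ γ {s} G H =
  let t , (s″ , p , eq) , t≤ = runScript l μ (γ [ g ]≔ v) G′ (trans (heap′ r) H)
  in  _ , (s″ , ⇓seq (halts r) (⇓seq ⇓assign p) , eq) , +-mono-≤ (fast r) (+-monoʳ-≤ 2 t≤)
  where
  open Execution μ γ (sum γ) (lookup≤sum γ)
  open Run
  v = ⟦ e ⟧ μ γ []
  r = run e record
    { globals = G ; locals = λ () ; below = λ () ; room = ≤-refl ; heap = H }
  G′ : ∀ h → (registers (final r) [ toℕ g ↦ registers (final r) 4 ]) (toℕ h) ≡
             lookup (γ [ g ]≔ v) h
  G′ h with h Fin.≟ g
  ... | yes refl = trans (update-same (registers (final r)) (toℕ h) _)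
                         (trans (result r) (sym (lookup∘updateAt h γ)))
  ... | no h≢g   = trans (update-other (registers (final r)) _ (h≢g ∘ Fin.toℕ-injective))
                         (trans (frame r (Fin.toℕ<n h))
                           (trans (G h) (sym (lookup∘updateAt′ h g h≢g γ))))

-- Polynomial bounds on running times

PolynomiallyBounded : (ℕ → ℕ) → Set
PolynomiallyBounded p = ∃[ C ] ∃[ D ] ∀ B .{{_ : NonZero B}} → p B ≤ C * B ^ D

poly-const : ∀ c → PolynomiallyBounded (λ _ → c)
poly-const c = c , 0 , λ B → ≤-reflexive (sym (*-identityʳ c))

-- Adding the exponents brings both bounds to a common power; enlarging an exponent is sound because
-- `B` is nonzero.
poly-+ : ∀ {p q} → PolynomiallyBounded p → PolynomiallyBounded q →
  PolynomiallyBounded (λ B → p B + q B)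
poly-+ {p} {q} (C , D , p≤) (C′ , D′ , q≤) = C + C′ , D + D′ , λ B → begin
  p B + q B                              ≤⟨ +-mono-≤ (p≤ B) (q≤ B) ⟩
  C * B ^ D + C′ * B ^ D′
    ≤⟨ +-mono-≤ (*-monoʳ-≤ C (^-monoʳ-≤ B (m≤m+n D D′))) (*-monoʳ-≤ C′ (^-monoʳ-≤ B (m≤n+m D′ D))) ⟩
  C * B ^ (D + D′) + C′ * B ^ (D + D′)   ≡⟨ *-distribʳ-+ (B ^ (D + D′)) C C′ ⟨
  (C + C′) * B ^ (D + D′)                ∎
  where open ≤-Reasoning

poly-B* : ∀ {p} → PolynomiallyBounded p → PolynomiallyBounded (λ B → B * p B)
poly-B* {p} (C , D , p≤) = C , suc D , λ B → begin
  B * p B          ≤⟨ *-monoʳ-≤ B (p≤ B) ⟩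
  B * (C * B ^ D)  ≡⟨ *-assoc B C _ ⟨
  B * C * B ^ D    ≡⟨ cong (_* B ^ D) (*-comm B C) ⟩
  C * B * B ^ D    ≡⟨ *-assoc C B _ ⟩
  C * (B * B ^ D)  ∎
  where open ≤-Reasoning

time-poly : ∀ {m} (e : Exp m) → PolynomiallyBounded (time e)
time-poly (con c)       = poly-const 2
time-poly (var x)       = poly-const 2
time-poly (glob g)      = poly-const 2
time-poly (mem e)       = poly-+ (time-poly e) (poly-const 3)
time-poly (e +ᵉ e′)     = poly-+ (time-poly e) (poly-+ (time-poly e′) (poly-const 4))
time-poly (e ∸ᵉ e′)     = poly-+ (time-poly e) (poly-+ (time-poly e′) (poly-const 4))
time-poly (condᵉ e x y) =
  poly-+ (time-poly e) (poly-+ (poly-const 2) (poly-+ (time-poly x) (time-poly y)))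
time-poly (loopᵉ g e b) =
  poly-+ (time-poly e) (poly-+ (poly-const 2)
    (poly-+ (poly-B* (poly-+ (poly-const 8) (time-poly b))) (poly-const 2)))
time-poly (letᵉ e b)    = poly-+ (time-poly e) (poly-+ (time-poly b) (poly-const 2))

time-mono : ∀ {m} (e : Exp m) {B B′} → B ≤ B′ → time e B ≤ time e B′
time-mono (con c)       le = ≤-refl
time-mono (var x)       le = ≤-refl
time-mono (glob g)      le = ≤-refl
time-mono (mem e)       le = +-monoˡ-≤ 3 (time-mono e le)
time-mono (e +ᵉ e′)     le = +-mono-≤ (time-mono e le) (+-monoˡ-≤ 4 (time-mono e′ le))
time-mono (e ∸ᵉ e′)     le = +-mono-≤ (time-mono e le) (+-monoˡ-≤ 4 (time-mono e′ le))
time-mono (condᵉ e x y) le =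
  +-mono-≤ (time-mono e le) (+-monoʳ-≤ 2 (+-mono-≤ (time-mono x le) (time-mono y le)))
time-mono (loopᵉ g e b) le =
  +-mono-≤ (time-mono e le)
    (+-monoʳ-≤ 2 (+-monoˡ-≤ 2 (*-mono-≤ le (+-monoʳ-≤ 8 (time-mono b le)))))
time-mono (letᵉ e b)    le = +-mono-≤ (time-mono e le) (+-monoˡ-≤ 2 (time-mono b le))

-- Only states in which an expression is evaluated count, so the final result enters no bound.
peak : Script → (ℕ → ℕ) → Vec ℕ 4 → ℕ
peak [] μ γ            = 0
peak ((g , e) ∷ l) μ γ = sum γ ⊔ peak l μ (γ [ g ]≔ ⟦ e ⟧ μ γ [])

-- `C` and `D` are chosen before `μ` and `γ`; this is what keeps the final exponent independent of
-- graph and parameter.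
scriptTime-poly : ∀ l → ∃[ C ] ∃[ D ] ∀ μ γ B .{{_ : NonZero B}} →
  peak l μ γ ≤ B → scriptTime l μ γ ≤ C * B ^ D
scriptTime-poly l =
  let C , D , q≤ = poly l
  in  C , D , λ μ γ B le → ≤-trans (bound l μ γ le) (q≤ B)
  where
  total : Script → ℕ → ℕ
  total []            B = 1
  total ((g , e) ∷ l) B = time e B + (2 + total l B)

  poly : ∀ l → PolynomiallyBounded (total l)
  poly []            = poly-const 1
  poly ((g , e) ∷ l) = poly-+ (time-poly e) (poly-+ (poly-const 2) (poly l))

  bound : ∀ l μ γ {B} → peak l μ γ ≤ B → scriptTime l μ γ ≤ total l B
  bound [] μ γ le = ≤-refl
  bound ((g , e) ∷ l) μ γ le =
    +-mono-≤ (time-mono e (≤-trans (m≤m⊔n _ _) le))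
      (+-monoʳ-≤ 2 (bound l μ _ (≤-trans (m≤n⊔m (sum γ) _) le)))

-- Numbers of kept vertices per class

∑-zero : ∀ {n} {f : Fin n → ℕ} → (∀ i → f i ≡ 0) → ∑ f ≡ 0
∑-zero {n} f≡0 = trans (sum-cong-≗ f≡0) (sum-replicate-zero n)

∑-mono : ∀ {n} {f g : Fin n → ℕ} → (∀ i → f i ≤ g i) → ∑ f ≤ ∑ g
∑-mono {zero}  f≤g = z≤n
∑-mono {suc n} f≤g = +-mono-≤ (f≤g zero) (∑-mono (f≤g ∘ suc))

∑-single : ∀ {n} (f : Fin n → ℕ) i → ∑ (λ j → if does (i Fin.≟ j) then f j else 0) ≡ f i
∑-single {suc n} f zero = trans (cong (f zero +_) (sum-replicate-zero n)) (+-identityʳ _)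
∑-single f (suc i)        = ∑-single (f ∘ suc) i

-- Digit `2 + j` means that `j` vertices of the class are deleted, so one set of `3 + k * k` digits
-- serves every class size.
decode : ℕ → ℕ → ℕ
decode 0             s = 0
decode 1             s = 1
decode (suc (suc j)) s = s ∸ j

module _ {k : ℕ} (A : Fin k → Fin k → Bool) (Q : Fin k → Bool) where

  degree : (Fin k → ℕ) → Fin k → ℕ
  degree X c = ∑ λ c′ → if A c c′ then X c′ else 0

  -- `A` will be adjacency between classes, false on the diagonal, and `Q` will mark the cliques;
  -- `clique` then leaves no edge between kept vertices of one class.
  record Valid (X : Fin k → ℕ) : Set where
    field
      clique    : ∀ c → Q c ≡ true → X c ≤ 1
      irregular : ∀ c c′ → A c c′ ≡ true → X c ≢ 0 → X c′ ≢ 0 → degree X c ≢ degree X c′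

  open Valid

  _[_:=_] : (Fin k → ℕ) → Fin k → ℕ → Fin k → ℕ
  (X [ c₀ := y ]) c = if does (c₀ Fin.≟ c) then y else X c

  :=-same : ∀ X c₀ y → (X [ c₀ := y ]) c₀ ≡ y
  :=-same X c₀ y with c₀ Fin.≟ c₀
  ... | yes _ = refl
  ... | no ≢  = contradiction refl ≢

  :=-other : ∀ X {c₀ c} y → c ≢ c₀ → (X [ c₀ := y ]) c ≡ X c
  :=-other X {c₀} {c} y c≢ with c₀ Fin.≟ c
  ... | yes refl = contradiction refl c≢
  ... | no _     = refl

  :=-self : ∀ X c₀ c → X c ≡ (X [ c₀ := X c₀ ]) c
  :=-self X c₀ c with c₀ Fin.≟ c
  ... | yes refl = refl
  ... | no _     = refl

  degree-cong : ∀ {X Y} → (∀ c → X c ≡ Y c) → ∀ c → degree X c ≡ degree Y c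
  degree-cong X≗Y c = sum-cong-≗ λ c′ → cong (λ z → if A c c′ then z else 0) (X≗Y c′)

  -- Affine in `y`: the constant term is the degree with `c₀` emptied, and the slope is 1 or 0 as
  -- `A c c₀` decides.
  degree-:= : ∀ X c₀ y c →
    degree (X [ c₀ := y ]) c ≡ degree (X [ c₀ := 0 ]) c + (if A c c₀ then y else 0)
  degree-:= X c₀ y c = begin
    degree (X [ c₀ := y ]) c
      ≡⟨ sum-cong-≗ (λ c′ → split (A c c′) (does (c₀ Fin.≟ c′)) (X c′)) ⟩
    ∑ (λ c′ → rest c′ + (if does (c₀ Fin.≟ c′) then at c′ else 0))
      ≡⟨ ∑-distrib-+ rest _ ⟩
    degree (X [ c₀ := 0 ]) c + ∑ (λ c′ → if does (c₀ Fin.≟ c′) then at c′ else 0)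
      ≡⟨ cong (degree (X [ c₀ := 0 ]) c +_) (∑-single at c₀) ⟩
    degree (X [ c₀ := 0 ]) c + at c₀ ∎
    where
    open ≡-Reasoning
    at rest : Fin k → ℕ
    at c′   = if A c c′ then y else 0
    rest c′ = if A c c′ then (X [ c₀ := 0 ]) c′ else 0
    split : ∀ a b x → (if a then (if b then y else x) else 0) ≡
      (if a then (if b then 0 else x) else 0) + (if b then (if a then y else 0) else 0)
    split true  true  x = refl
    split true  false x = sym (+-identityʳ x)
    split false true  x = refl
    split false false x = refl

  Conflict : (Fin k → ℕ) → Fin k → Fin k → Set
  Conflict X c c′ = A c c′ ≡ true × X c ≢ 0 × X c′ ≢ 0 × degree X c ≡ degree X c′

  conflict? : ∀ X c c′ → Dec (Conflict X c c′)
  conflict? X c c′ =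
    (A c c′ Bool.≟ true) ×-dec ¬? (X c ≟ 0) ×-dec ¬? (X c′ ≟ 0) ×-dec (degree X c ≟ degree X c′)

  -- As functions of y the two degrees have slopes 0 or 1; equal slopes would
  -- carry a conflict over to X itself.
  conflict-unique : ∀ {X c₀ y y′ c c′} → Valid X → X c₀ ≢ 0 →
    Conflict (X [ c₀ := y ]) c c′ → Conflict (X [ c₀ := y′ ]) c c′ → y ≡ y′
  conflict-unique {X} {c₀} {y} {y′} {c} {c′} V X₀ (a , p , p′ , eq) (_ , _ , _ , eq′) =
    solve (A c c₀) (A c′ c₀) (shifted y eq) (shifted y′ eq′)
      (λ e → irregular V c c′ a (nonzero p) (nonzero p′)
        (trans (restore c) (trans e (sym (restore c′)))))
    where
    E : Fin k → ℕ
    E = degree (X [ c₀ := 0 ])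

    shifted : ∀ z → degree (X [ c₀ := z ]) c ≡ degree (X [ c₀ := z ]) c′ →
      E c + (if A c c₀ then z else 0) ≡ E c′ + (if A c′ c₀ then z else 0)
    shifted z e = trans (sym (degree-:= X c₀ z c)) (trans e (degree-:= X c₀ z c′))

    restore : ∀ b → degree X b ≡ E b + (if A b c₀ then X c₀ else 0)
    restore b = trans (degree-cong (:=-self X c₀) b) (degree-:= X c₀ (X c₀) b)

    nonzero : ∀ {b} → (X [ c₀ := y ]) b ≢ 0 → X b ≢ 0
    nonzero {b} ≢0 with c₀ Fin.≟ b
    ... | yes refl = X₀
    ... | no _     = ≢0

    solve : ∀ i j →
      E c + (if i then y else 0) ≡ E c′ + (if j then y else 0) →
      E c + (if i then y′ else 0) ≡ E c′ + (if j then y′ else 0) →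
      E c + (if i then X c₀ else 0) ≢ E c′ + (if j then X c₀ else 0) → y ≡ y′
    solve true  true  e e′ ≢ = contradiction (cong (_+ X c₀) (+-cancelʳ-≡ y _ _ e)) ≢
    solve true  false e e′ ≢ = +-cancelˡ-≡ (E c) _ _ (trans e (sym e′))
    solve false true  e e′ ≢ = +-cancelˡ-≡ (E c′) _ _ (trans (sym e) e′)
    solve false false e e′ ≢ = contradiction e ≢

  module _ (s : Fin k → ℕ) where

    Coded : (Fin k → ℕ) → Fin k → Set
    Coded X c = ∃[ d ] d < 3 + k * k × X c ≡ decode d (s c)

    -- `coded` lets the classes be treated one after another: a digit once secured survives later
    -- changes. `above` guarantees that no change deletes more vertices.
    record Improves (X Y : Fin k → ℕ) : Set where
      field
        valid : Valid Y
        fits  : ∀ c → Y c ≤ s c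
        above : ∀ c → X c ≤ Y c
        coded : ∀ c → Coded X c → Coded Y c

    open Improves

    improve : ∀ X → Valid X → (∀ c → X c ≤ s c) → ∀ c₀ →
      ∃[ Y ] Improves X Y × Coded Y c₀
    improve X V X≤s c₀ with X c₀ in X₀
    ... | 0 = X , record { valid = V ; fits = X≤s ; above = λ _ → ≤-refl ; coded = λ _ p → p }
                , 0 , z<s , X₀
    ... | 1 = X , record { valid = V ; fits = X≤s ; above = λ _ → ≤-refl ; coded = λ _ p → p }
                , 1 , s<s z<s , X₀
    ... | x@(suc (suc _)) with s c₀ ∸ x ≤? k * k
    ...   | yes near = X , record { valid = V ; fits = X≤s ; above = λ _ → ≤-refl ; coded = λ _ p → p }
                , 2 + (s c₀ ∸ x) , +-monoʳ-≤ 3 near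
                , trans X₀ (sym (m∸[m∸n]≡n (subst (_≤ s c₀) X₀ (X≤s c₀))))
    ...   | no far
      with Fin.all? (λ (j : Fin (suc (k * k))) → Fin.any? λ c → Fin.any? λ c′ →
                       conflict? (X [ c₀ := s c₀ ∸ toℕ j ]) c c′)
    ...     | yes all =
      -- Among `k * k + 1` values and `k * k` pairs, two values conflict at the same pair and so
      -- coincide by `conflict-unique`.
      let i , j , i<j , eq = Fin.pigeonhole (n<1+n (k * k)) (λ j → combine (fst j) (snd j))
          eq₁ , eq₂ = Fin.combine-injective _ _ _ _ eq
          yᵢ≡yⱼ = conflict-unique V (λ X₀≡0 → 1+n≢0 (trans (sym X₀) X₀≡0)) (conflict i)
            (subst₂ (Conflict _) (sym eq₁) (sym eq₂) (conflict j))
      in contradiction (∸-cancelˡ-≡ (j≤s i) (j≤s j) yᵢ≡yⱼ) (<⇒≢ i<j)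
      where
      fst snd : Fin (suc (k * k)) → Fin k
      fst j = proj₁ (all j)
      snd j = proj₁ (proj₂ (all j))
      conflict : ∀ j → Conflict (X [ c₀ := s c₀ ∸ toℕ j ]) (fst j) (snd j)
      conflict j = proj₂ (proj₂ (all j))
      -- `far` gives `k * k < s c₀`, so no subtraction truncates and distinct `j` yield distinct
      -- values.
      j≤s : (j : Fin (suc (k * k))) → toℕ j ≤ s c₀
      j≤s j = ≤-trans (s≤s⁻¹ (Fin.toℕ<n j)) (≤-trans (<⇒≤ (≰⇒> far)) (m∸n≤m (s c₀) x))
    ...     | no ¬all with Fin.¬∀⟶∃¬ _ _ (λ j → Fin.any? λ c → Fin.any? λ c′ →
                             conflict? (X [ c₀ := s c₀ ∸ toℕ j ]) c c′) ¬all
    ...       | j , ¬bad = Y , improves , digit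
      where
      y = s c₀ ∸ toℕ j
      Y = X [ c₀ := y ]

      j≤ : toℕ j ≤ k * k
      j≤ = s≤s⁻¹ (Fin.toℕ<n j)

      x≤s : x ≤ s c₀
      x≤s = subst (_≤ s c₀) X₀ (X≤s c₀)

      x≤y : x ≤ y
      x≤y = begin
        x                  ≡⟨ m∸[m∸n]≡n x≤s ⟨
        s c₀ ∸ (s c₀ ∸ x)  ≤⟨ ∸-monoʳ-≤ (s c₀) (≤-trans j≤ (<⇒≤ (≰⇒> far))) ⟩
        s c₀ ∸ toℕ j       ∎
        where open ≤-Reasoning

      digit : Coded Y c₀
      digit = 2 + toℕ j , +-monoʳ-≤ 3 j≤ , :=-same X c₀ y

      improves : Improves X Y
      improves .valid .clique c q with c₀ Fin.≟ c
      -- `X c₀` is at least 2, so `c₀` is not a clique.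
      ... | yes refl = contradiction (subst (_≤ 1) X₀ (clique V c q)) λ { (s≤s ()) }
      ... | no _     = clique V c q
      improves .valid .irregular c c′ a p p′ e = ¬bad (c , c′ , a , p , p′ , e)
      improves .fits c with c₀ Fin.≟ c
      ... | yes refl = m∸n≤m (s c₀) (toℕ j)
      ... | no _     = X≤s c
      improves .above c with c₀ Fin.≟ c
      ... | yes refl = subst (_≤ y) (sym X₀) x≤y
      ... | no _     = ≤-refl
      improves .coded c (d , d< , eq) with c Fin.≟ c₀
      ... | yes refl = digit
      ... | no c≢    = d , d< , trans (:=-other X y c≢) eq

    improveAll : ∀ l X → Valid X → (∀ c → X c ≤ s c) →
      ∃[ Y ] Improves X Y × (∀ {c} → c ∈ l → Coded Y c)
    improveAll [] X V X≤s =
      X , record { valid = V ; fits = X≤s ; above = λ _ → ≤-refl ; coded = λ _ p → p } , λ ()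
    improveAll (c ∷ l) X V X≤s =
      let Y , X⊑Y , Yc = improve X V X≤s c
          Z , Y⊑Z , Zl = improveAll l Y (valid X⊑Y) (fits X⊑Y)
      in  Z
        , record { valid = valid Y⊑Z ; fits = fits Y⊑Z
                 ; above = λ b → ≤-trans (above X⊑Y b) (above Y⊑Z b)
                 ; coded = λ b → coded Y⊑Z b ∘ coded X⊑Y b }
        , λ { (here refl) → coded Y⊑Z c Yc ; (there b∈l) → Zl b∈l }

    normalise : ∀ X → Valid X → (∀ c → X c ≤ s c) →
      ∃[ Y ] Valid Y × (∀ c → X c ≤ Y c) × (∀ c → Coded Y c)
    normalise X V X≤s =
      let Y , X⊑Y , all = improveAll (allFin k) X V X≤s
      in  Y , valid X⊑Y , above X⊑Y , λ c → all (∈-allFin c)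

-- Twin classes

𝟙 : Bool → ℕ
𝟙 b = if b then 1 else 0

count : ∀ {n} → (Fin n → Bool) → ℕ
count b = ∑ λ i → 𝟙 (b i)

true≢false : ∀ {b} → b ≡ true → b ≢ false
true≢false refl ()

does-true : ∀ {P : Set} (P? : Dec P) → does P? ≡ true → P
does-true (yes p) _ = p

if-∑ : ∀ {n} b (f : Fin n → ℕ) → (if b then ∑ f else 0) ≡ ∑ (λ i → if b then f i else 0)
if-∑ true  f = refl
if-∑ {n} false f = sym (sum-replicate-zero n)

∑-nonzero : ∀ {n} (f : Fin n → ℕ) → ∑ f ≢ 0 → ∃[ i ] f i ≢ 0
∑-nonzero {zero}  f ∑≢0 = contradiction refl ∑≢0
∑-nonzero {suc n} f ∑≢0 with f zero in f₀
... | suc _ = zero , λ f₀≡0 → 1+n≢0 (trans (sym f₀) f₀≡0)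
... | zero  = let i , fᵢ≢0 = ∑-nonzero (f ∘ suc) ∑≢0 in suc i , fᵢ≢0

term≤∑ : ∀ {n} (f : Fin n → ℕ) i → f i ≤ ∑ f
term≤∑ f zero    = m≤m+n _ _
term≤∑ f (suc i) = ≤-trans (term≤∑ (f ∘ suc) i) (m≤n+m _ (f zero))

count≤1 : ∀ {n} (b : Fin n → Bool) → (∀ i j → b i ≡ true → b j ≡ true → i ≡ j) → count b ≤ 1
count≤1 {zero}  b unique = z≤n
count≤1 {suc n} b unique with b zero in b₀
... | false = count≤1 (b ∘ suc) λ i j p q → Fin.suc-injective (unique (suc i) (suc j) p q)
... | true  = s≤s (≤-reflexive (∑-zero λ i → cong 𝟙 (Bool.¬-not λ bᵢ → Fin.0≢1+n (unique zero (suc i) b₀ bᵢ))))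

count≤1⇒unique : ∀ {n} (b : Fin n → Bool) → count b ≤ 1 → ∀ i j → b i ≡ true → b j ≡ true → i ≡ j
count≤1⇒unique b le zero    zero    p q = refl
count≤1⇒unique b le (suc i) (suc j) p q =
  cong suc (count≤1⇒unique (b ∘ suc) (≤-trans (m≤n+m _ (𝟙 (b zero))) le) i j p q)
count≤1⇒unique b le zero (suc j) p q rewrite p =
  contradiction (subst (λ z → 𝟙 z ≤ 0) q (≤-trans (term≤∑ (𝟙 ∘ b ∘ suc) j) (s≤s⁻¹ le))) λ ()
count≤1⇒unique b le (suc i) zero p q = sym (count≤1⇒unique b le zero (suc i) q p)

least : ∀ {n} {P : Fin n → Set} → Decidable P → ∃[ i ] P i →
  ∃[ i ] P i × (∀ j → toℕ j < toℕ i → ¬ P j)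
least {suc n} P? (i , Pi) with P? zero
... | yes P₀ = zero , P₀ , λ j ()
least {suc n} P? (zero , P₀)   | no ¬P₀ = contradiction P₀ ¬P₀
least {suc n} P? (suc i , Pi)  | no ¬P₀ =
  let m , Pm , min = least (P? ∘ suc) (i , Pi)
  in  suc m , Pm , λ { zero _ → ¬P₀ ; (suc j) (s≤s j<m) → min j j<m }

∣p∣≡count : ∀ {n} (p : Subset n) → ∣ p ∣ ≡ count (lookup p)
∣p∣≡count []          = refl
∣p∣≡count (true ∷ p)  = cong suc (∣p∣≡count p)
∣p∣≡count (false ∷ p) = ∣p∣≡count p

lookup-minus : ∀ {n} (p : Subset n) x i →
  lookup (p - x) i ≡ (if does (x Fin.≟ i) then false else lookup p i)
lookup-minus (true  ∷ p) zero zero    = refl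
lookup-minus (false ∷ p) zero zero    = refl
lookup-minus (_ ∷ p) zero (suc i)     = cong (λ q → lookup q i) (p─⊥≡p p)
lookup-minus (true  ∷ p) (suc x) zero = refl
lookup-minus (false ∷ p) (suc x) zero = refl
lookup-minus (_ ∷ p) (suc x) (suc i)  = lookup-minus p x i

module _ {n : ℕ} (G : Graph n) where

  lookup-N-minus : ∀ u v i →
    lookup (N G u - v) i ≡ (if does (v Fin.≟ i) then false else adj G u i)
  lookup-N-minus u v i = trans (lookup-minus (N G u) v i)
    (cong (λ b → if does (v Fin.≟ i) then false else b) (lookup∘tabulate (adj G u) i))

  adj⇒≢ : ∀ {u v} → adj G u v ≡ true → u ≢ v
  adj⇒≢ {u} a refl = true≢false a (Graph.irrefl G u)

  twins⇒adj : ∀ {u v} → Twins G u v → ∀ w → w ≢ u → w ≢ v → adj G u w ≡ adj G v w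
  twins⇒adj {u} {v} tw w w≢u w≢v = begin
    adj G u w             ≡⟨ cong (if_then false else adj G u w) (dec-false (v Fin.≟ w) (w≢v ∘ sym)) ⟨
    _                     ≡⟨ lookup-N-minus u v w ⟨
    lookup (N G u - v) w  ≡⟨ cong (λ p → lookup p w) tw ⟩
    lookup (N G v - u) w  ≡⟨ lookup-N-minus v u w ⟩
    _                     ≡⟨ cong (if_then false else adj G v w) (dec-false (u Fin.≟ w) (w≢u ∘ sym)) ⟩
    adj G v w             ∎
    where open ≡-Reasoning

  -- At `w = u` and `w = v` both sides are false: one deletes the vertex, the other has no loop
  -- there.
  adj⇒twins : ∀ {u v} → (∀ w → w ≢ u → w ≢ v → adj G u w ≡ adj G v w) → Twins G u v
  adj⇒twins {u} {v} same = trans (sym (tabulate∘lookup _))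
    (trans (tabulate-cong pointwise) (tabulate∘lookup _))
    where
    agree : ∀ w → (if does (v Fin.≟ w) then false else adj G u w) ≡
                  (if does (u Fin.≟ w) then false else adj G v w)
    agree w with v Fin.≟ w | u Fin.≟ w
    ... | yes _    | yes _    = refl
    ... | yes refl | no _     = sym (Graph.irrefl G v)
    ... | no _     | yes refl = Graph.irrefl G u
    ... | no v≢w   | no u≢w   = same w (u≢w ∘ sym) (v≢w ∘ sym)
    pointwise : ∀ w → lookup (N G u - v) w ≡ lookup (N G v - u) w
    pointwise w = trans (lookup-N-minus u v w) (trans (agree w) (sym (lookup-N-minus v u w)))

  -- Unlike the cardinality of an intersection, a sum over all vertices can be regrouped by twin
  -- class.
  degreeOn : (Fin n → Bool) → Fin n → ℕ
  degreeOn χ u = ∑ λ w → if adj G u w then 𝟙 (χ w) else 0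

  Irregular : (Fin n → Bool) → Set
  Irregular χ = ∀ u v → χ u ≡ true → χ v ≡ true → adj G u v ≡ true → degreeOn χ u ≢ degreeOn χ v

  degreeIn≡degreeOn : ∀ W u → degreeIn G W u ≡ degreeOn (lookup W) u
  degreeIn≡degreeOn W u = trans (∣p∣≡count (N G u ∩ W)) (sum-cong-≗ λ w →
    trans (cong 𝟙 (trans (lookup-zipWith _∧_ w (N G u) W)
                         (cong (_∧ lookup W w) (lookup∘tabulate (adj G u) w))))
          (𝟙-∧ (adj G u w)))
    where
    𝟙-∧ : ∀ a {b} → 𝟙 (a ∧ b) ≡ (if a then 𝟙 b else 0)
    𝟙-∧ true  = refl
    𝟙-∧ false = refl

  irregular⇒ : ∀ W → LocallyIrregularOn G W → Irregular (lookup W)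
  irregular⇒ W I u v u∈ v∈ a eq = I u v (lookup⇒[]= u W u∈) (lookup⇒[]= v W v∈) a
    (trans (degreeIn≡degreeOn W u) (trans eq (sym (degreeIn≡degreeOn W v))))

  irregular⇐ : ∀ W → Irregular (lookup W) → LocallyIrregularOn G W
  irregular⇐ W I u v u∈ v∈ a eq = I u v ([]=⇒lookup u∈) ([]=⇒lookup v∈) a
    (trans (sym (degreeIn≡degreeOn W u)) (trans eq (degreeIn≡degreeOn W v)))

-- Push-forward along the class map: the constant 1 yields class sizes, a characteristic function
-- the numbers of kept vertices.
fibre : ∀ {n k} → (Fin n → Fin k) → (Fin n → ℕ) → Fin k → ℕ
fibre cl f c = ∑ λ w → if does (cl w Fin.≟ c) then f w else 0

∑-fibre : ∀ {n k} (cl : Fin n → Fin k) f → ∑ (fibre cl f) ≡ ∑ f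
∑-fibre cl f = trans (∑-comm (λ c w → if does (cl w Fin.≟ c) then f w else 0))
  (sum-cong-≗ λ w → ∑-single (λ _ → f w) (cl w))

fibre-cong : ∀ {n k} (cl : Fin n → Fin k) {f g} → (∀ w → f w ≡ g w) → ∀ c → fibre cl f c ≡ fibre cl g c
fibre-cong cl f≗g c = sum-cong-≗ λ w → cong (λ z → if does (cl w Fin.≟ c) then z else 0) (f≗g w)

fibre-+ : ∀ {n k} (cl : Fin n → Fin k) f g c →
  fibre cl (λ w → f w + g w) c ≡ fibre cl f c + fibre cl g c
fibre-+ cl f g c = trans (sum-cong-≗ λ w → split (does (cl w Fin.≟ c)))
  (∑-distrib-+ (λ w → if does (cl w Fin.≟ c) then f w else 0) _)
  where
  split : ∀ b {x y} → (if b then x + y else 0) ≡ (if b then x else 0) + (if b then y else 0)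
  split true  = refl
  split false = refl

-- Greedy along the vertices: the first one is kept exactly if its class still demands a vertex, and
-- then that demand drops by one.
realise : ∀ {n k} (cl : Fin n → Fin k) (X : Fin k → ℕ) → (∀ c → X c ≤ fibre cl (λ _ → 1) c) →
  Σ[ χ ∈ (Fin n → Bool) ] (∀ c → fibre cl (𝟙 ∘ χ) c ≡ X c)
realise {zero}  cl X X≤ = (λ ()) , λ c → sym (n≤0⇒n≡0 (X≤ c))
realise {suc n} cl X X≤ with X (cl zero) in X₀
... | zero = χ , correct
  where
  smaller : ∀ c → X c ≤ fibre (cl ∘ suc) (λ _ → 1) c
  smaller c with cl zero Fin.≟ c | X≤ c
  ... | yes refl | _  = subst (_≤ _) (sym X₀) z≤n
  ... | no _     | le = le
  rest = realise (cl ∘ suc) X smaller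
  χ : Fin (suc n) → Bool
  χ zero    = false
  χ (suc i) = proj₁ rest i
  correct : ∀ c → fibre cl (𝟙 ∘ χ) c ≡ X c
  correct c with cl zero Fin.≟ c
  ... | yes refl = proj₂ rest c
  ... | no _     = proj₂ rest c
... | suc x = χ , correct
  where
  Y : Fin _ → ℕ
  Y c = if does (cl zero Fin.≟ c) then x else X c
  smaller : ∀ c → Y c ≤ fibre (cl ∘ suc) (λ _ → 1) c
  smaller c with cl zero Fin.≟ c | X≤ c
  ... | yes refl | le = s≤s⁻¹ (subst (_≤ _) X₀ le)
  ... | no _     | le = le
  rest = realise (cl ∘ suc) Y smaller
  χ : Fin (suc n) → Bool
  χ zero    = true
  χ (suc i) = proj₁ rest i
  correct : ∀ c → fibre cl (𝟙 ∘ χ) c ≡ X c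
  correct c with cl zero Fin.≟ c | proj₂ rest c
  ... | yes refl | eq = trans (cong suc eq) (sym X₀)
  ... | no _     | eq = eq

-- Kept vertex sets versus numbers of kept vertices

module Classes {n : ℕ} (G : Graph n) {k : ℕ} (nd : NeighbourhoodDiversity G k) where

  open NeighbourhoodDiversity nd public renaming (classOf to cl)

  size : Fin k → ℕ
  size = fibre cl λ _ → 1

  -- The least vertex of a class is recognisable without `classOf`: it has no smaller twin. The
  -- program finds the classes this way.
  leader : ∀ c → ∃[ u ] cl u ≡ c × (∀ v → toℕ v < toℕ u → cl v ≢ c)
  leader c = let u , eq = surjective c in least (λ u → cl u Fin.≟ c) (u , eq refl)

  rep : Fin k → Fin n
  rep c = proj₁ (leader c)

  cl-rep : ∀ c → cl (rep c) ≡ c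
  cl-rep c = proj₁ (proj₂ (leader c))

  A : Fin k → Fin k → Bool
  A c c′ = not (does (c Fin.≟ c′)) ∧ adj G (rep c) (rep c′)

  -- One edge at the representative suffices, since a class with an edge is complete. A singleton is
  -- not marked; its size already caps it at one vertex.
  clique? : ∀ c → Dec (∃[ v ] cl v ≡ c × adj G (rep c) v ≡ true)
  clique? c = Fin.any? λ v → (cl v Fin.≟ c) ×-dec (adj G (rep c) v Bool.≟ true)

  Q : Fin k → Bool
  Q c = does (clique? c)

  adj-cl : ∀ {u v} w → cl u ≡ cl v → w ≢ u → w ≢ v → adj G u w ≡ adj G v w
  adj-cl {u} {v} w eq = twins⇒adj G (Equivalence.to (sameClass u v) eq) w

  -- The endpoints move to their representatives one at a time; the classes differ, so neither a
  -- moving endpoint nor its target meets the other endpoint.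
  adj-A : ∀ u v → cl u ≢ cl v → adj G u v ≡ A (cl u) (cl v)
  adj-A u v ≢ rewrite dec-false (cl u Fin.≟ cl v) ≢ = begin
    adj G u v                          ≡⟨ adj-cl v (sym (cl-rep (cl u))) (λ { refl → ≢ refl })
                                            (λ { refl → ≢ (sym (cl-rep (cl u))) }) ⟩
    adj G (rep (cl u)) v               ≡⟨ Graph.sym G _ _ ⟩
    adj G v (rep (cl u))               ≡⟨ adj-cl (rep (cl u)) (sym (cl-rep (cl v)))
                                            (λ eq → ≢ (trans (sym (cl-rep (cl u))) (cong cl eq)))
                                            (λ eq → ≢ (trans (sym (cl-rep (cl u))) (trans (cong cl eq) (cl-rep (cl v))))) ⟩
    adj G (rep (cl v)) (rep (cl u))    ≡⟨ Graph.sym G _ _ ⟩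
    adj G (rep (cl u)) (rep (cl v))    ∎
    where open ≡-Reasoning

  A⇒≢ : ∀ {c c′} → A c c′ ≡ true → c ≢ c′
  A⇒≢ {c} a refl rewrite dec-true (c Fin.≟ c) refl = contradiction a λ ()

  shift : ∀ {a b w} → adj G a b ≡ true → cl b ≡ cl w → w ≢ a → adj G a w ≡ true
  shift {a} {b} {w} ab eq w≢a = begin
    adj G a w  ≡⟨ Graph.sym G a w ⟩
    adj G w a  ≡⟨ adj-cl a eq (adj⇒≢ G ab) (w≢a ∘ sym) ⟨
    adj G b a  ≡⟨ Graph.sym G b a ⟩
    adj G a b  ≡⟨ ab ⟩
    true       ∎
    where open ≡-Reasoning

  -- Half of the dichotomy for twin classes: one edge inside a class provides an edge at each of its
  -- vertices. `shift` then slides the far end to every other vertex.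
  neighbour : ∀ {a b u} → adj G a b ≡ true → cl a ≡ cl b → cl u ≡ cl a →
    ∃[ x ] cl x ≡ cl u × adj G u x ≡ true
  neighbour {a} {b} {u} ab a~b u~a with u Fin.≟ b
  ... | yes refl = a , sym u~a , trans (Graph.sym G u a) ab
  ... | no u≢b   = b , trans (sym a~b) (sym u~a) ,
    trans (Graph.sym G u b) (shift (trans (Graph.sym G b a) ab) (sym u~a) u≢b)

  complete : ∀ {a b u w} → adj G a b ≡ true → cl a ≡ cl b → cl u ≡ cl a → cl w ≡ cl a →
    u ≢ w → adj G u w ≡ true
  complete ab a~b u~a w~a u≢w =
    let x , x~u , ux = neighbour ab a~b u~a
    in  shift ux (trans x~u (trans u~a (sym w~a))) (u≢w ∘ sym)

  module _ (χ : Fin n → Bool) where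

    X : Fin k → ℕ
    X = fibre cl (𝟙 ∘ χ)

    X≡count : ∀ c → X c ≡ count (λ w → does (cl w Fin.≟ c) ∧ χ w)
    X≡count c = sum-cong-≗ λ w → swap (does (cl w Fin.≟ c))
      where
      swap : ∀ a {b} → (if a then 𝟙 b else 0) ≡ 𝟙 (a ∧ b)
      swap true  = refl
      swap false = refl

    member : ∀ {c} → X c ≢ 0 → ∃[ u ] cl u ≡ c × χ u ≡ true
    member {c} X≢0 with ∑-nonzero _ X≢0
    ... | u , ≢0 with cl u Fin.≟ c | χ u in χu
    ...   | yes eq | true  = u , eq , χu
    ...   | yes _  | false = contradiction refl ≢0
    ...   | no _   | _     = contradiction refl ≢0

    X≢0 : ∀ {u} → χ u ≡ true → X (cl u) ≢ 0
    X≢0 {u} χu X≡0 = contradiction (≤-trans one (≤-trans (term≤∑ _ u) (≤-reflexive X≡0))) λ ()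
      where
      one : 1 ≤ (if does (cl u Fin.≟ cl u) then 𝟙 (χ u) else 0)
      one rewrite dec-true (cl u Fin.≟ cl u) refl | χu = ≤-refl

    -- Kept twins are allowed as long as they are not adjacent.
    NoTwins : Set
    NoTwins = ∀ u v → χ u ≡ true → χ v ≡ true → cl u ≡ cl v → adj G u v ≡ false

    -- Without edges between kept twins, `u` gets nothing from its own class, and it sees every
    -- other class entirely or not at all.
    degree-X : NoTwins → ∀ u → χ u ≡ true → degreeOn G χ u ≡ degree A Q X (cl u)
    degree-X free u χu = begin
      degreeOn G χ u
        ≡⟨ sum-cong-≗ (λ w → at w (cl u Fin.≟ cl w)) ⟩
      ∑ (λ w → if A (cl u) (cl w) then 𝟙 (χ w) else 0)
        ≡⟨ ∑-fibre cl _ ⟨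
      ∑ (fibre cl λ w → if A (cl u) (cl w) then 𝟙 (χ w) else 0)
        ≡⟨ sum-cong-≗ (λ c → trans (if-∑ (A (cl u) c) λ w → if does (cl w Fin.≟ c) then 𝟙 (χ w) else 0)
             (sum-cong-≗ λ w → exchange c w)) ⟨
      degree A Q X (cl u) ∎
      where
      open ≡-Reasoning
      at : ∀ w → Dec (cl u ≡ cl w) → (if adj G u w then 𝟙 (χ w) else 0) ≡ (if A (cl u) (cl w) then 𝟙 (χ w) else 0)
      at w (no ≢)  = cong (if_then 𝟙 (χ w) else 0) (adj-A u w ≢)
      -- Here `A` is false; a kept `w` is not adjacent to `u` by `free`, and a deleted `w` adds 0.
      at w (yes eq) rewrite dec-true (cl u Fin.≟ cl w) eq with χ w in χw
      ... | true  rewrite free u w χu χw eq = refl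
      ... | false with adj G u w
      ...   | true  = refl
      ...   | false = refl
      exchange : ∀ c w → (if A (cl u) c then (if does (cl w Fin.≟ c) then 𝟙 (χ w) else 0) else 0) ≡
        (if does (cl w Fin.≟ c) then (if A (cl u) (cl w) then 𝟙 (χ w) else 0) else 0)
      exchange c w with cl w Fin.≟ c
      ... | yes refl = refl
      ... | no _ with A (cl u) c
      ...   | true  = refl
      ...   | false = refl

    -- Adjacent twins have the same closed neighbourhood: once each vertex is counted with its
    -- neighbours, the two sums agree term by term, and the extra 1 cancels.
    irregular⇒noTwins : Irregular G χ → NoTwins
    irregular⇒noTwins I u v χu χv eq = Bool.¬-not λ a → I u v χu χv a
      (+-cancelʳ-≡ 1 _ _ (begin
        degreeOn G χ u + 1
          ≡⟨ cong (degreeOn G χ u +_) (∑-single (λ _ → 1) u) ⟨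
        degreeOn G χ u + ∑ (λ w → if does (u Fin.≟ w) then 1 else 0)
          ≡⟨ ∑-distrib-+ (λ w → if adj G u w then 𝟙 (χ w) else 0) _ ⟨
        ∑ (λ w → (if adj G u w then 𝟙 (χ w) else 0) + (if does (u Fin.≟ w) then 1 else 0))
          ≡⟨ sum-cong-≗ (same a) ⟩
        ∑ (λ w → (if adj G v w then 𝟙 (χ w) else 0) + (if does (v Fin.≟ w) then 1 else 0))
          ≡⟨ ∑-distrib-+ (λ w → if adj G v w then 𝟙 (χ w) else 0) _ ⟩
        degreeOn G χ v + ∑ (λ w → if does (v Fin.≟ w) then 1 else 0)
          ≡⟨ cong (degreeOn G χ v +_) (∑-single (λ _ → 1) v) ⟩
        degreeOn G χ v + 1 ∎))
      where
      open ≡-Reasoning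
      same : adj G u v ≡ true → ∀ w →
        (if adj G u w then 𝟙 (χ w) else 0) + (if does (u Fin.≟ w) then 1 else 0) ≡
        (if adj G v w then 𝟙 (χ w) else 0) + (if does (v Fin.≟ w) then 1 else 0)
      same a w with u Fin.≟ w | v Fin.≟ w
      ... | yes refl | yes refl = refl
      ... | yes refl | no _ rewrite Graph.irrefl G u | trans (Graph.sym G v u) a | χu = refl
      ... | no _ | yes refl rewrite Graph.irrefl G v | a | χv = refl
      ... | no u≢w | no v≢w rewrite adj-cl w eq (u≢w ∘ sym) (v≢w ∘ sym) = refl

    irregular⇒valid : Irregular G χ → Valid A Q X
    irregular⇒valid I = record
      { clique = λ c q → subst (_≤ 1) (sym (X≡count c)) (count≤1 _ (unique c (does-true (clique? c) q)))
      ; irregular = λ c c′ a p p′ → distinct a (member p) (member p′)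
      }
      where
      free = irregular⇒noTwins I
      unique : ∀ c → (∃[ v ] cl v ≡ c × adj G (rep c) v ≡ true) → ∀ i j →
        does (cl i Fin.≟ c) ∧ χ i ≡ true → does (cl j Fin.≟ c) ∧ χ j ≡ true → i ≡ j
      unique c (v , cv , a) i j p q with cl i Fin.≟ c | cl j Fin.≟ c | i Fin.≟ j
      ... | yes _  | yes _  | yes i≡j = i≡j
      ... | yes ci | yes cj | no i≢j  = contradiction (free i j p q (trans ci (sym cj)))
        (true≢false (complete a (trans (cl-rep c) (sym cv)) (trans ci (sym (cl-rep c))) (trans cj (sym (cl-rep c))) i≢j))
      distinct : ∀ {c c′} → A c c′ ≡ true → (∃[ u ] cl u ≡ c × χ u ≡ true) →
        (∃[ v ] cl v ≡ c′ × χ v ≡ true) → degree A Q X c ≢ degree A Q X c′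
      distinct a (u , refl , χu) (v , refl , χv) eq =
        I u v χu χv (trans (adj-A u v (A⇒≢ a)) a)
          (trans (degree-X free u χu) (trans eq (sym (degree-X free v χv))))

    -- An edge between twins makes their class a clique, which keeps at most one vertex, so the two
    -- ends would coincide.
    valid⇒noTwins : Valid A Q X → NoTwins
    valid⇒noTwins V u v χu χv u~v = Bool.¬-not λ a → adj⇒≢ G a
      (count≤1⇒unique _ (subst (_≤ 1) (X≡count (cl u)) (Valid.clique V (cl u) (q a)))
        u v (both refl χu) (both (sym u~v) χv))
      where
      both : ∀ {w} → cl w ≡ cl u → χ w ≡ true → does (cl w Fin.≟ cl u) ∧ χ w ≡ true
      both {w} eq χw rewrite dec-true (cl w Fin.≟ cl u) eq = χw
      q : adj G u v ≡ true → Q (cl u) ≡ true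
      q a = let x , x~ , rx = neighbour a u~v (cl-rep (cl u))
            in  dec-true (clique? (cl u)) (x , trans x~ (cl-rep (cl u)) , rx)

    valid⇒irregular : Valid A Q X → Irregular G χ
    valid⇒irregular V u v χu χv a eq with cl u Fin.≟ cl v
    ... | yes u~v = true≢false a (valid⇒noTwins V u v χu χv u~v)
    ... | no u≁v  = Valid.irregular V (cl u) (cl v) (trans (sym (adj-A u v u≁v)) a)
      (X≢0 χu) (X≢0 χv)
      (trans (sym (degree-X free u χu)) (trans eq (degree-X free v χv)))
      where free = valid⇒noTwins V

    size-split : ∀ c → size c ≡ X c + fibre cl (𝟙 ∘ not ∘ χ) c
    size-split c = trans (fibre-cong cl (λ w → either (χ w)) c) (fibre-+ cl _ _ c)
      where
      either : ∀ b → 1 ≡ 𝟙 b + 𝟙 (not b)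
      either true  = refl
      either false = refl

    X≤size : ∀ c → X c ≤ size c
    X≤size c = ≤-trans (m≤m+n _ _) (≤-reflexive (sym (size-split c)))

    removed : ∑ (λ c → size c ∸ X c) ≡ count (not ∘ χ)
    removed = trans
      (sum-cong-≗ λ c → trans (cong (_∸ X c) (size-split c)) (m+n∸m≡n (X c) _))
      (∑-fibre cl _)

  valid-cong : ∀ {X Y} → (∀ c → X c ≡ Y c) → Valid A Q X → Valid A Q Y
  valid-cong X≗Y V = record
    { clique    = λ c q → subst (_≤ 1) (X≗Y c) (Valid.clique V c q)
    ; irregular = λ c c′ a p p′ eq → Valid.irregular V c c′ a
        (p ∘ trans (sym (X≗Y c))) (p′ ∘ trans (sym (X≗Y c′)))
        (trans (degree-cong A Q X≗Y c) (trans eq (sym (degree-cong A Q X≗Y c′))))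
    }

  -- Any choice of `Y c` vertices from each class will do, because validity sees only the counts.
  valid⇒irregulator : ∀ Y → Valid A Q Y → (∀ c → Y c ≤ size c) →
    ∃[ S ] VertexIrregulator G S × ∣ S ∣ ≡ ∑ (λ c → size c ∸ Y c)
  valid⇒irregulator Y V Y≤ = S
    , irregular⇐ G (∁ S) (valid⇒irregular _ (valid-cong same V))
    , (begin
        ∣ S ∣                       ≡⟨ ∣p∣≡count S ⟩
        count (lookup S)            ≡⟨ sum-cong-≗ (λ w → cong 𝟙 (lookup∘tabulate (not ∘ χ) w)) ⟩
        count (not ∘ χ)             ≡⟨ removed χ ⟨
        ∑ (λ c → size c ∸ X χ c)    ≡⟨ sum-cong-≗ (λ c → cong (size c ∸_) (fibres c)) ⟩
        ∑ (λ c → size c ∸ Y c)      ∎)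
    where
    open ≡-Reasoning
    χ = proj₁ (realise cl Y Y≤)
    fibres = proj₂ (realise cl Y Y≤)
    S = tabulate (not ∘ χ)
    same : ∀ c → Y c ≡ X (lookup (∁ S)) c
    same c = trans (sym (fibres c)) (fibre-cong cl (λ w → cong 𝟙 (begin
      χ w               ≡⟨ Bool.not-involutive (χ w) ⟨
      not (not (χ w))   ≡⟨ cong not (lookup∘tabulate (not ∘ χ) w) ⟨
      not (lookup S w)  ≡⟨ lookup-map w not S ⟨
      lookup (∁ S) w    ∎)) c)

  irregulator⇒valid : ∀ S → VertexIrregulator G S →
    ∃[ Y ] Valid A Q Y × (∀ c → Y c ≤ size c) × ∑ (λ c → size c ∸ Y c) ≡ ∣ S ∣
  irregulator⇒valid S I = X χ , irregular⇒valid χ (irregular⇒ G (∁ S) I) , X≤size χ , (begin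
    ∑ (λ c → size c ∸ X χ c)  ≡⟨ removed χ ⟩
    count (not ∘ χ)           ≡⟨ sum-cong-≗ (λ w → cong 𝟙 (trans (cong not (lookup-map w not S)) (Bool.not-involutive (lookup S w)))) ⟩
    count (lookup S)          ≡⟨ ∣p∣≡count S ⟨
    ∣ S ∣                     ∎)
    where
    open ≡-Reasoning
    χ = lookup (∁ S)

-- Truth values of loop expressions

-- Every nonzero number counts as true, so addition is disjunction, a sum is an existential
-- quantifier, and truncated subtraction is a strict comparison.
data Tests : ℕ → Set → Set₁ where
  holds : ∀ {x P} → P → Tests (suc x) P
  fails : ∀ {P} → ¬ P → Tests 0 P

tests-map : ∀ {x P Q} → (P → Q) → (Q → P) → Tests x P → Tests x Q
tests-map f g (holds p)  = holds (f p)
tests-map f g (fails ¬p) = fails (¬p ∘ g)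

tests-≢0 : ∀ x → Tests x (x ≢ 0)
tests-≢0 zero    = fails λ ≢ → ≢ refl
tests-≢0 (suc x) = holds λ ()

tests-not : ∀ {x P} → Tests x P → Tests (cond x 0 1) (¬ P)
tests-not (holds p)  = fails λ ¬p → ¬p p
tests-not (fails ¬p) = holds ¬p

tests-and : ∀ {x y P Q} → Tests x P → (P → Tests y Q) → Tests (cond x y 0) (P × Q)
tests-and (holds p)  t = tests-map (p ,_) proj₂ (t p)
tests-and (fails ¬p) t = fails (¬p ∘ proj₁)

tests-or : ∀ {x y P Q} → Tests x P → Tests y Q → Tests (x + y) (P ⊎ Q)
tests-or (holds p)  _          = holds (inj₁ p)
tests-or (fails ¬p) (holds q)  = holds (inj₂ q)
tests-or (fails ¬p) (fails ¬q) = fails [ ¬p , ¬q ]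

tests-< : ∀ a b → Tests (b ∸ a) (a < b)
tests-< zero    zero    = fails λ ()
tests-< zero    (suc b) = holds z<s
tests-< (suc a) zero    = fails λ ()
tests-< (suc a) (suc b) = tests-map s<s s<s⁻¹ (tests-< a b)

tests-≢ : ∀ a b → Tests ((a ∸ b) + (b ∸ a)) (a ≢ b)
tests-≢ zero    zero    = fails λ ≢ → ≢ refl
tests-≢ zero    (suc b) = holds λ ()
tests-≢ (suc a) zero    = holds λ ()
tests-≢ (suc a) (suc b) = tests-map (λ ≢ → ≢ ∘ suc-injective) (λ ≢ → ≢ ∘ cong suc) (tests-≢ a b)

tests-𝟙 : ∀ b → Tests (𝟙 b) (b ≡ true)
tests-𝟙 true  = holds refl
tests-𝟙 false = fails λ ()

cond-dec : ∀ {x y z P} → Tests x P → (P? : Dec P) → cond x y z ≡ (if does P? then y else z)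
cond-dec (holds _)  (yes _) = refl
cond-dec (holds p)  (no ¬p) = contradiction p ¬p
cond-dec (fails ¬p) (yes p) = contradiction p ¬p
cond-dec (fails _)  (no _)  = refl

cond-bool : ∀ {x y z b} → Tests x (b ≡ true) → cond x y z ≡ (if b then y else z)
cond-bool (holds refl) = refl
cond-bool {b = true}  (fails ≢) = contradiction refl ≢
cond-bool {b = false} (fails _) = refl

∑-const : ∀ n x → ∑ {n} (λ _ → x) ≡ n * x
∑-const zero    x = refl
∑-const (suc n) x = cong (x +_) (∑-const n x)

-- `fold↓` consumes the largest index first, whereas `∑` splits off the smallest.
∑-last : ∀ {n} (f : Fin (suc n) → ℕ) → ∑ f ≡ f (fromℕ n) + ∑ (f ∘ inject₁)
∑-last {zero}  f = refl
∑-last {suc n} f = begin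
  f zero + ∑ (f ∘ suc)                                          ≡⟨ cong (f zero +_) (∑-last (f ∘ suc)) ⟩
  f zero + (f (fromℕ (suc n)) + ∑ (f ∘ suc ∘ inject₁))          ≡⟨ +-assoc (f zero) _ _ ⟨
  f zero + f (fromℕ (suc n)) + ∑ (f ∘ suc ∘ inject₁)            ≡⟨ cong (_+ ∑ (f ∘ suc ∘ inject₁)) (+-comm (f zero) _) ⟩
  f (fromℕ (suc n)) + f zero + ∑ (f ∘ suc ∘ inject₁)            ≡⟨ +-assoc (f (fromℕ (suc n))) (f zero) _ ⟩
  f (fromℕ (suc n)) + (f zero + ∑ (f ∘ suc ∘ inject₁))          ∎
  where open ≡-Reasoning

fold-∑ : ∀ n {h} (g : Fin n → ℕ) z → (∀ i a → h (toℕ i) a ≡ a + g i) → fold↓ n h z ≡ z + ∑ g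
fold-∑ zero    g z eq = sym (+-identityʳ z)
fold-∑ (suc n) {h} g z eq = begin
  fold↓ n h (h n z)                               ≡⟨ cong (λ i → fold↓ n h (h i z)) (Fin.toℕ-fromℕ n) ⟨
  fold↓ n h (h (toℕ (fromℕ n)) z)                 ≡⟨ cong (fold↓ n h) (eq (fromℕ n) z) ⟩
  fold↓ n h (z + g (fromℕ n))                     ≡⟨ fold-∑ n (g ∘ inject₁) _ (λ i a →
                                                       trans (cong (λ j → h j a) (sym (Fin.toℕ-inject₁ i)))
                                                             (eq (inject₁ i) a)) ⟩
  z + g (fromℕ n) + ∑ (g ∘ inject₁)               ≡⟨ +-assoc z _ _ ⟩
  z + (g (fromℕ n) + ∑ (g ∘ inject₁))             ≡⟨ cong (z +_) (∑-last g) ⟨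
  z + ∑ g                                         ∎
  where open ≡-Reasoning

tests-fold : ∀ n {v : ℕ → ℕ → ℕ} {P : Fin n → Set} {z Z} → (∀ i a → Tests (v (toℕ i) a) (P i)) →
  Tests z Z → Tests (fold↓ n (λ i a → a + v i a) z) (Z ⊎ ∃[ i ] P i)
tests-fold zero    t tz = tests-map inj₁ [ (λ p → p) , (λ ()) ] tz
tests-fold (suc n) {v} {P} {Z = Z} t tz = tests-map into onto
  (tests-fold n (λ i a → subst (λ j → Tests (v j a) (P (inject₁ i))) (Fin.toℕ-inject₁ i) (t (inject₁ i) a))
    (tests-or tz (subst (λ j → Tests (v j _) (P (fromℕ n))) (Fin.toℕ-fromℕ n) (t (fromℕ n) _))))
  where
  into : (Z ⊎ P (fromℕ n)) ⊎ (∃[ i ] P (inject₁ i)) → Z ⊎ (∃[ i ] P i)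
  into (inj₁ (inj₁ p)) = inj₁ p
  into (inj₁ (inj₂ p)) = inj₂ (fromℕ n , p)
  into (inj₂ (i , p))  = inj₂ (inject₁ i , p)
  onto : Z ⊎ (∃[ i ] P i) → (Z ⊎ P (fromℕ n)) ⊎ (∃[ i ] P (inject₁ i))
  onto (inj₁ p) = inj₁ (inj₁ p)
  onto (inj₂ (i , p)) with view i
  ... | ‵fromℕ     = inj₁ (inj₂ p)
  ... | ‵inject₁ j = inj₂ (j , p)

-- Turns comparisons into a number; a quotient is read off this way, provided that it does not
-- exceed the loop range.
count-below : ∀ M e → e ≤ M → ∑ {M} (λ i → 𝟙 (does (toℕ i <? e))) ≡ e
count-below zero    zero    le       = refl
count-below (suc M) zero    le       = ∑-zero {suc M} λ i → refl
count-below (suc M) (suc e) (s≤s le) = cong suc (count-below M e le)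

-- The values that fail `P` form an initial segment, so their number is the first value that
-- satisfies it.
count-least : ∀ n {P : ℕ → Set} (P? : ∀ b → Dec (P b)) →
  (∀ {a b} → a ≤ b → P a → P b) → P n →
  let m = ∑ {n} (λ b → 𝟙 (does (¬? (P? (toℕ b))))) in P m × (∀ b → P b → m ≤ b)
count-least zero    P? mono Pn = Pn , λ _ _ → z≤n
count-least (suc n) {P} P? mono Pn with P? 0
... | yes P₀ = subst P (sym all) P₀ , λ b _ → subst (_≤ b) (sym all) z≤n
  where
  all : ∑ {n} (λ b → 𝟙 (does (¬? (P? (suc (toℕ b)))))) ≡ 0
  all = ∑-zero {n} λ b → cong 𝟙 (dec-false (¬? (P? (suc (toℕ b)))) λ ¬P → ¬P (mono z≤n P₀))
... | no ¬P₀ =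
  let Pm , min = count-least n (P? ∘ suc) (mono ∘ s≤s) Pn
  in  Pm , λ { zero P₀ → contradiction P₀ ¬P₀ ; (suc b) Pb → s≤s (min b Pb) }

-- The algorithm

↑ : ∀ {m} → Fin m → Fin (2 + m)
↑ x = suc (suc x)

idx acc : ∀ {m} → Fin (2 + m)
idx = zero
acc = suc zero

gn gk gR gM : Fin 4
gn = zero
gk = suc zero
gR = suc (suc zero)
gM = suc (suc (suc zero))

sumᵉ : ∀ {m} → Fin 4 → Exp (2 + m) → Exp m
sumᵉ g e = loopᵉ g (con 0) (var acc +ᵉ e)

notᵉ : ∀ {m} → Exp m → Exp m
notᵉ e = condᵉ e (con 0) (con 1)

andᵉ : ∀ {m} → Exp m → Exp m → Exp m
andᵉ e e′ = condᵉ e e′ (con 0)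

neqᵉ : ∀ {m} → Exp m → Exp m → Exp m
neqᵉ e e′ = (e ∸ᵉ e′) +ᵉ (e′ ∸ᵉ e)

-- There is no multiplication: n u is the sum of n copies of u.
adjᵉ : ∀ {m} → Fin m → Fin m → Exp m
adjᵉ u v = mem (sumᵉ gn (var (↑ u)) +ᵉ var v)

twinᵉ : ∀ {m} → Fin m → Fin m → Exp m
twinᵉ u v = notᵉ (sumᵉ gn
  (andᵉ (neqᵉ (var idx) (var (↑ u)))
  (andᵉ (neqᵉ (var idx) (var (↑ v)))
        (neqᵉ (adjᵉ (↑ u) idx) (adjᵉ (↑ v) idx)))))

repᵉ : ∀ {m} → Fin m → Exp m
repᵉ u = notᵉ (sumᵉ gn (andᵉ (var (↑ u) ∸ᵉ var idx) (twinᵉ idx (↑ u))))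

-- `twinᵉ` is a negation and so exactly 0 or 1; its sum counts the class, each vertex being its own
-- twin.
sizeᵉ : ∀ {m} → Fin m → Exp m
sizeᵉ u = sumᵉ gn (twinᵉ idx (↑ u))

-- The quotient q / R is the number of i with (i + 1) R ≤ q.
divᵉ : ∀ {m} → Fin m → Exp m
divᵉ q = sumᵉ gM (notᵉ ((sumᵉ gR (var (↑ idx)) +ᵉ glob gR) ∸ᵉ var (↑ q)))

-- Each class stores its digit of t at its least vertex, larger vertices in lower
-- places; one division by R per least vertex above v exposes the digit of v.
quotᵉ : ∀ {m} → Fin m → Fin m → Exp m
quotᵉ t v = loopᵉ gn (var t)
  (condᵉ (andᵉ (var idx ∸ᵉ var (↑ v)) (repᵉ idx)) (divᵉ acc) (var acc))

-- The residue modulo `R` of the value of `quotᵉ`.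
digitᵉ : ∀ {m} → Fin m → Fin m → Exp m
digitᵉ t v = letᵉ (quotᵉ t v) (letᵉ (divᵉ zero) (var (suc zero) ∸ᵉ sumᵉ gR (var (↑ zero))))

keptᵉ : ∀ {m} → Fin m → Fin m → Exp m
keptᵉ t u = letᵉ (digitᵉ t u)
  (condᵉ (var zero)
    (condᵉ (var zero ∸ᵉ con 1) (sizeᵉ (suc u) ∸ᵉ (var zero ∸ᵉ con 2)) (con 1))
    (con 0))

linkᵉ : ∀ {m} → Fin m → Fin m → Exp m
linkᵉ u v = andᵉ (notᵉ (twinᵉ u v)) (adjᵉ u v)

cliqueᵉ : ∀ {m} → Fin m → Exp m
cliqueᵉ u = sumᵉ gn (andᵉ (twinᵉ idx (↑ u)) (adjᵉ (↑ u) idx))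

degreeᵉ : ∀ {m} → Fin m → Fin m → Exp m
degreeᵉ t u = sumᵉ gn (andᵉ (repᵉ idx) (andᵉ (linkᵉ (↑ u) idx) (keptᵉ (↑ t) idx)))

conflictᵉ : ∀ {m} → Fin m → Fin m → Fin m → Exp m
conflictᵉ t u v = andᵉ (linkᵉ u v) (andᵉ (keptᵉ t u) (andᵉ (keptᵉ t v)
  (notᵉ (neqᵉ (degreeᵉ t u) (degreeᵉ t v)))))

validᵉ : ∀ {m} → Fin m → Exp m
validᵉ t = notᵉ (sumᵉ gn (andᵉ (repᵉ idx)
  (andᵉ (cliqueᵉ idx) (keptᵉ (↑ t) idx ∸ᵉ con 1) +ᵉ
   sumᵉ gn (andᵉ (repᵉ idx) (conflictᵉ (↑ (↑ t)) (↑ idx) idx)))))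

removedᵉ : ∀ {m} → Fin m → Exp m
removedᵉ t = sumᵉ gn (andᵉ (repᵉ idx) (sizeᵉ idx ∸ᵉ keptᵉ (↑ t) idx))

classesᵉ : ∀ {m} → Exp m
classesᵉ = sumᵉ gn (repᵉ idx)

radixᵉ : ∀ {m} → Fin 4 → Exp m
radixᵉ g = con 3 +ᵉ sumᵉ g (glob g)

powerᵉ : ∀ {m} → Fin 4 → Fin 4 → Exp m
powerᵉ b g = loopᵉ g (con 1) (sumᵉ b (var (↑ acc)))

-- The minimum is the number of budgets b < n that no valid candidate meets.
minimumᵉ : ∀ {m} → Exp m
minimumᵉ = sumᵉ gn (notᵉ (sumᵉ gM (andᵉ (validᵉ idx) (notᵉ (removedᵉ idx ∸ᵉ var (↑ idx))))))

-- What loop expressions compute and decide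

module Semantics (μ : ℕ → ℕ) (γ : Vec ℕ 4) where

  record Computes {m} (e : Exp m) (ρ : Vec ℕ m) (x : ℕ) : Set where
    constructor computes
    field value : ⟦ e ⟧ μ γ ρ ≡ x

  record Decides {m} (e : Exp m) (ρ : Vec ℕ m) (P : Set) : Set₁ where
    constructor decides
    field test : Tests (⟦ e ⟧ μ γ ρ) P

  open Computes public
  open Decides public

  module _ {m} {ρ : Vec ℕ m} where

    ⟦var⟧ : ∀ {x a} → lookup ρ x ≡ a → Computes (var x) ρ a
    ⟦var⟧ = computes

    ⟦con⟧ : ∀ {a} → Computes (con a) ρ a
    ⟦con⟧ = computes refl

    ⟦∸⟧ : ∀ {e e′ a b} → Computes e ρ a → Computes e′ ρ b → Computes (e ∸ᵉ e′) ρ (a ∸ b)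
    ⟦∸⟧ (computes p) (computes q) = computes (cong₂ _∸_ p q)

    ⟦+⟧ : ∀ {e e′ a b} → Computes e ρ a → Computes e′ ρ b → Computes (e +ᵉ e′) ρ (a + b)
    ⟦+⟧ (computes p) (computes q) = computes (cong₂ _+_ p q)

    ⟦mem⟧ : ∀ {e a} → Computes e ρ a → Computes (mem e) ρ (μ a)
    ⟦mem⟧ (computes p) = computes (cong μ p)

    ⟦cond⟧ : ∀ {e e′ e″ a b c} → Computes e ρ a → Computes e′ ρ b → Computes e″ ρ c →
      Computes (condᵉ e e′ e″) ρ (cond a b c)
    ⟦cond⟧ (computes refl) (computes refl) (computes refl) = computes refl

    ⟦let⟧ : ∀ {e b x y} → Computes e ρ x → Computes b (x ∷ ρ) y → Computes (letᵉ e b) ρ y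
    ⟦let⟧ (computes refl) (computes q) = computes q

    ⟦sum⟧ : ∀ g {e} (f : Fin (lookup γ g) → ℕ) →
      (∀ i a → Computes e (toℕ i ∷ a ∷ ρ) (f i)) → Computes (sumᵉ g e) ρ (∑ f)
    ⟦sum⟧ g f eq = computes (fold-∑ (lookup γ g) f 0 λ i a → cong (a +_) (value (eq i a)))

    ⟦mul⟧ : ∀ g {e x} → (∀ i a → Computes e (i ∷ a ∷ ρ) x) →
      Computes (sumᵉ g e) ρ (lookup γ g * x)
    ⟦mul⟧ g {x = x} eq = computes (trans
      (value (⟦sum⟧ g (λ _ → x) λ i a → eq (toℕ i) a)) (∑-const (lookup γ g) x))

    ⟦≡⟧ : ∀ {e a b} → a ≡ b → Computes e ρ a → Computes e ρ b
    ⟦≡⟧ refl c = c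

    ⟦if⟧ : ∀ {e e′ a} b → Decides e ρ (b ≡ true) → Computes e′ ρ a →
      Computes (andᵉ e e′) ρ (if b then a else 0)
    ⟦if⟧ b (decides t) (computes refl) = computes (cond-bool t)

    -- The passage from truth values to numbers: negation normalises any nonzero value, so its
    -- results can be summed.
    ⟦not⟧ : ∀ {e P} (P? : Dec P) → Decides (notᵉ e) ρ P → Computes (notᵉ e) ρ (𝟙 (does P?))
    ⟦not⟧ {e} P? (decides t) = computes (trans (idem (⟦ e ⟧ μ γ ρ)) (cond-dec t P?))
      where
      idem : ∀ x → cond x 0 1 ≡ cond (cond x 0 1) 1 0
      idem zero    = refl
      idem (suc x) = refl

    by : ∀ {e P Q} → (P → Q) → (Q → P) → Decides e ρ P → Decides e ρ Q
    by f g (decides t) = decides (tests-map f g t)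

    not? : ∀ {e P} → Decides e ρ P → Decides (notᵉ e) ρ (¬ P)
    not? (decides t) = decides (tests-not t)

    guard? : ∀ {e e′ P Q} → Decides e ρ P → (P → Decides e′ ρ Q) → Decides (andᵉ e e′) ρ (P × Q)
    guard? (decides t) t′ = decides (tests-and t (test ∘ t′))

    and? : ∀ {e e′ P Q} → Decides e ρ P → Decides e′ ρ Q → Decides (andᵉ e e′) ρ (P × Q)
    and? t t′ = guard? t λ _ → t′

    decision : ∀ {e P} → Decides e ρ P → Dec P
    decision {e} (decides t) with ⟦ e ⟧ μ γ ρ | t
    ... | _ | holds p  = yes p
    ... | _ | fails ¬p = no ¬p

    or? : ∀ {e e′ P Q} → Decides e ρ P → Decides e′ ρ Q → Decides (e +ᵉ e′) ρ (P ⊎ Q)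
    or? (decides t) (decides t′) = decides (tests-or t t′)

    lt? : ∀ {e e′ a b} → Computes e ρ a → Computes e′ ρ b → Decides (e′ ∸ᵉ e) ρ (a < b)
    lt? {a = a} {b} (computes refl) (computes refl) = decides (tests-< a b)

    neq? : ∀ {e e′ a b} → Computes e ρ a → Computes e′ ρ b → Decides (neqᵉ e e′) ρ (a ≢ b)
    neq? {a = a} {b} (computes refl) (computes refl) = decides (tests-≢ a b)

    nonzero? : ∀ {e a} → Computes e ρ a → Decides e ρ (a ≢ 0)
    nonzero? {a = a} (computes refl) = decides (tests-≢0 a)

    exists? : ∀ g {e} {P : Fin (lookup γ g) → Set} →
      (∀ i a → Decides e (toℕ i ∷ a ∷ ρ) (P i)) → Decides (sumᵉ g e) ρ (∃[ i ] P i)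
    exists? g {e} t = decides (tests-map [ (λ ()) , (λ p → p) ] inj₂
      (tests-fold (lookup γ g) {v = λ i a → ⟦ e ⟧ μ γ (i ∷ a ∷ ρ)}
        (λ i a → test (t i a)) (fails λ (p : ⊥) → p)))

  module _ {m} {ρ : Vec ℕ m} where

    ⟦radix⟧ : ∀ g → Computes (radixᵉ g) ρ (3 + lookup γ g * lookup γ g)
    ⟦radix⟧ g = ⟦+⟧ ⟦con⟧ (⟦mul⟧ g λ _ _ → computes refl)

    ⟦power⟧ : ∀ b g → Computes (powerᵉ b g) ρ (lookup γ b ^ lookup γ g)
    ⟦power⟧ b g = computes (trans (iterated (lookup γ g) 1) (*-identityʳ _))
      where
      open ≡-Reasoning
      step : ℕ → ℕ → ℕ
      step i a = ⟦ sumᵉ b (var (↑ acc)) ⟧ μ γ (i ∷ a ∷ ρ)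
      iterated : ∀ j z → fold↓ j step z ≡ lookup γ b ^ j * z
      iterated zero    z = sym (+-identityʳ z)
      iterated (suc j) z = begin
        fold↓ j step (step j z)
          ≡⟨ cong (fold↓ j step) (value {ρ = j ∷ z ∷ ρ} (⟦mul⟧ b {var (↑ acc)} (λ _ _ → ⟦var⟧ refl))) ⟩
        fold↓ j step (lookup γ b * z)      ≡⟨ iterated j _ ⟩
        lookup γ b ^ j * (lookup γ b * z)  ≡⟨ *-assoc (lookup γ b ^ j) _ z ⟨
        lookup γ b ^ j * lookup γ b * z    ≡⟨ cong (_* z) (*-comm (lookup γ b ^ j) _) ⟩
        lookup γ b ^ suc j * z             ∎

-- Loop expressions for twin classes

adjacencyMatrix-combine : ∀ {n} (G : Graph n) u v →
  adjacencyMatrix G (toℕ (combine u v)) ≡ 𝟙 (adj G u v)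
adjacencyMatrix-combine {n} G u v with toℕ (combine u v) <? n * n
... | no ≮ = contradiction (Fin.toℕ<n (combine u v)) ≮
... | yes p = cong (λ uv → 𝟙 (adj G (proj₁ uv) (proj₂ uv)))
  (trans (cong (remQuot n) (Fin.fromℕ<-toℕ (combine u v) p)) (Fin.remQuot-combine u v))

-- The last three globals are arbitrary: classes are counted while these are still 0, and the search
-- runs with their final values.
module Meaning {n : ℕ} (G : Graph n) {k : ℕ} (nd : NeighbourhoodDiversity G k) (γ′ : Vec ℕ 3) where

  open Classes G nd
  open Semantics (adjacencyMatrix G) (n ∷ γ′)

  module _ {m} {ρ : Vec ℕ m} where

    ⟦adj⟧ : ∀ u v i j → lookup ρ u ≡ toℕ i → lookup ρ v ≡ toℕ j →
      Computes (adjᵉ u v) ρ (𝟙 (adj G i j))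
    ⟦adj⟧ u v i j eᵢ eⱼ = ⟦≡⟧
      (trans (cong (adjacencyMatrix G) (sym (Fin.toℕ-combine i j))) (adjacencyMatrix-combine G i j))
      (⟦mem⟧ (⟦+⟧ (⟦mul⟧ gn λ _ _ → ⟦var⟧ eᵢ) (⟦var⟧ eⱼ)))

    adj? : ∀ u v i j → lookup ρ u ≡ toℕ i → lookup ρ v ≡ toℕ j →
      Decides (adjᵉ u v) ρ (adj G i j ≡ true)
    adj? u v i j eᵢ eⱼ = decides
      (subst (λ x → Tests x _) (sym (value (⟦adj⟧ u v i j eᵢ eⱼ))) (tests-𝟙 (adj G i j)))

    distinct? : ∀ {u v} (i j : Fin n) → lookup ρ u ≡ toℕ i → lookup ρ v ≡ toℕ j →
      Decides (neqᵉ (var u) (var v)) ρ (i ≢ j)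
    distinct? i j eᵢ eⱼ = by (λ ≢ → ≢ ∘ cong toℕ) (λ ≢ → ≢ ∘ Fin.toℕ-injective)
      (neq? (⟦var⟧ eᵢ) (⟦var⟧ eⱼ))

  module _ {m} {ρ : Vec ℕ m} where

    twin? : ∀ u v i j → lookup ρ u ≡ toℕ i → lookup ρ v ≡ toℕ j →
      Decides (twinᵉ u v) ρ (cl i ≡ cl j)
    twin? u v i j eᵢ eⱼ = by
      (λ ¬diff → Equivalence.from (sameClass i j) (adj⇒twins G λ w w≢i w≢j →
        decidable-stable (_ Bool.≟ _) λ ≢ → ¬diff (w , w≢i , w≢j , ≢)))
      (λ eq (w , w≢i , w≢j , ≢) → ≢ (adj-cl w eq w≢i w≢j))
      (not? (exists? gn λ w a → and? (distinct? w i refl eᵢ) (and? (distinct? w j refl eⱼ)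
        (by (λ ≢ → ≢ ∘ cong 𝟙) (λ ≢ → ≢ ∘ 𝟙-injective)
          (neq? (⟦adj⟧ (↑ u) idx i w eᵢ refl) (⟦adj⟧ (↑ v) idx j w eⱼ refl))))))
      where
      𝟙-injective : ∀ {a b} → 𝟙 a ≡ 𝟙 b → a ≡ b
      𝟙-injective {true}  {true}  _ = refl
      𝟙-injective {false} {false} _ = refl

  module _ {m} {ρ : Vec ℕ m} where

    rep? : ∀ u i → lookup ρ u ≡ toℕ i → Decides (repᵉ u) ρ (rep (cl i) ≡ i)
    rep? u i eᵢ = by is-leader
      (λ eq (j , j<i , cj) → proj₂ (proj₂ (leader (cl i))) j
        (subst (toℕ j <_) (cong toℕ (sym eq)) j<i) cj)
      (not? (exists? gn λ j a → and? (lt? (⟦var⟧ refl) (⟦var⟧ eᵢ)) (twin? idx (↑ u) j i refl eᵢ)))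
      where
      is-leader : ¬ (∃[ j ] toℕ j < toℕ i × cl j ≡ cl i) → rep (cl i) ≡ i
      is-leader none with <-cmp (toℕ (rep (cl i))) (toℕ i)
      ... | tri< lt _ _ = contradiction (rep (cl i) , lt , cl-rep (cl i)) none
      ... | tri≈ _ eq _ = Fin.toℕ-injective eq
      ... | tri> _ _ gt = contradiction refl (proj₂ (proj₂ (leader (cl i))) i gt)

    ⟦size⟧ : ∀ u i → lookup ρ u ≡ toℕ i → Computes (sizeᵉ u) ρ (size (cl i))
    ⟦size⟧ u i eᵢ = ⟦sum⟧ gn _ λ j a → ⟦not⟧ (cl j Fin.≟ cl i) (twin? idx (↑ u) j i refl eᵢ)

  -- Each class has exactly one vertex with `rep (cl i) ≡ i`, so a loop over the vertices stands in
  -- for a sum over classes.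
  ∑-rep : (f : Fin k → ℕ) → ∑ (λ i → if does (rep (cl i) Fin.≟ i) then f (cl i) else 0) ≡ ∑ f
  ∑-rep f = trans (sym (∑-fibre cl _)) (sum-cong-≗ λ c → trans (sum-cong-≗ (at c)) (∑-single (λ _ → f c) (rep c)))
    where
    at : ∀ c i → (if does (cl i Fin.≟ c) then (if does (rep (cl i) Fin.≟ i) then f (cl i) else 0) else 0) ≡
      (if does (rep c Fin.≟ i) then f c else 0)
    at c i with cl i Fin.≟ c
    ... | yes refl = refl
    ... | no ≢ rewrite dec-false (rep c Fin.≟ i) (λ { refl → ≢ (cl-rep c) }) = refl

  module _ {m} {ρ : Vec ℕ m} where

    ⟦classes⟧ : Computes classesᵉ ρ k
    ⟦classes⟧ = ⟦≡⟧ (trans (∑-rep λ _ → 1) (trans (∑-const k 1) (*-identityʳ k)))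
      (⟦sum⟧ gn _ λ i a → ⟦not⟧ (rep (cl i) Fin.≟ i) (rep? idx i refl))

    ⟦∑rep⟧ : ∀ {e} (f : Fin k → ℕ) → (∀ c a → Computes e (toℕ (rep c) ∷ a ∷ ρ) (f c)) →
      Computes (sumᵉ gn (andᵉ (repᵉ idx) e)) ρ (∑ f)
    ⟦∑rep⟧ {e} f eq = ⟦≡⟧ (∑-rep f) (⟦sum⟧ gn _ λ i a → term i a (rep (cl i) Fin.≟ i))
      where
      term : ∀ i a (P? : Dec (rep (cl i) ≡ i)) →
        Computes (andᵉ (repᵉ idx) e) (toℕ i ∷ a ∷ ρ) (if does P? then f (cl i) else 0)
      term i a P? = computes (trans (cond-dec (test (rep? {ρ = toℕ i ∷ a ∷ ρ} idx i refl)) P?) (branch P?))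
        where
        branch : (P? : Dec (rep (cl i) ≡ i)) →
          (if does P? then ⟦ e ⟧ _ _ (toℕ i ∷ a ∷ ρ) else 0) ≡ (if does P? then f (cl i) else 0)
        branch (yes r) = value (subst (λ j → Computes e (toℕ j ∷ a ∷ ρ) (f (cl i))) r (eq (cl i) a))
        branch (no _)  = refl

    existsRep? : ∀ {e} {P : Fin k → Set} → (∀ c a → Decides e (toℕ (rep c) ∷ a ∷ ρ) (P c)) →
      Decides (sumᵉ gn (andᵉ (repᵉ idx) e)) ρ (∃[ c ] P c)
    existsRep? {e} {P} t = by (λ (i , _ , p) → cl i , p)
      (λ (c , p) → rep c , cong rep (cl-rep c) , subst P (sym (cl-rep c)) p)
      (exists? gn λ i a → guard? (rep? idx i refl) λ r →
        subst (λ j → Decides e (toℕ j ∷ a ∷ ρ) (P (cl i))) r (t (cl i) a))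

    link? : ∀ u v c c′ → lookup ρ u ≡ toℕ (rep c) → lookup ρ v ≡ toℕ (rep c′) →
      Decides (linkᵉ u v) ρ (A c c′ ≡ true)
    link? u v c c′ e e′ = by into onto
      (and? (not? (twin? u v (rep c) (rep c′) e e′)) (adj? u v (rep c) (rep c′) e e′))
      where
      into : cl (rep c) ≢ cl (rep c′) × adj G (rep c) (rep c′) ≡ true → A c c′ ≡ true
      into (≢ , a) rewrite dec-false (c Fin.≟ c′) (λ eq → ≢ (cong (cl ∘ rep) eq)) = a
      onto : A c c′ ≡ true → cl (rep c) ≢ cl (rep c′) × adj G (rep c) (rep c′) ≡ true
      onto a with c Fin.≟ c′
      ... | no ≢ = (λ eq → ≢ (trans (sym (cl-rep c)) (trans eq (cl-rep c′)))) , a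

    clique?ᵉ : ∀ u c → lookup ρ u ≡ toℕ (rep c) → Decides (cliqueᵉ u) ρ (Q c ≡ true)
    clique?ᵉ u c e = by
      (λ (v , v~ , a) → dec-true (clique? c) (v , trans v~ (cl-rep c) , a))
      (λ q → let v , v~ , a = does-true (clique? c) q in v , trans v~ (sym (cl-rep c)) , a)
      (exists? gn λ v a → and? (twin? idx (↑ u) v (rep c) refl e) (adj? (↑ u) idx (rep c) v e refl))

    ⟦sizeRep⟧ : ∀ u c → lookup ρ u ≡ toℕ (rep c) → Computes (sizeᵉ u) ρ (size c)
    ⟦sizeRep⟧ u c e = ⟦≡⟧ (cong size (cl-rep c)) (⟦size⟧ u (rep c) e)

-- Enumeration of the candidates

∑-toℕ : ∀ {g : ℕ → ℕ} {h : ℕ → ℕ} → h 0 ≡ 0 → (∀ m → h (suc m) ≡ g m + h m) →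
  ∀ m → h m ≡ ∑ {m} (g ∘ toℕ)
∑-toℕ h₀ hₛ zero    = h₀
∑-toℕ {g} {h} h₀ hₛ (suc m) = begin
  h (suc m)                                        ≡⟨ hₛ m ⟩
  g m + h m                                        ≡⟨ cong (g m +_) (∑-toℕ {g} {h} h₀ hₛ m) ⟩
  g m + ∑ {m} (g ∘ toℕ)                            ≡⟨ cong₂ _+_ (cong g (Fin.toℕ-fromℕ m))
                                                        (sum-cong-≗ {m} (λ i → cong g (Fin.toℕ-inject₁ i))) ⟨
  g (toℕ (fromℕ m)) + ∑ {m} (g ∘ toℕ ∘ inject₁)    ≡⟨ ∑-last {m} (g ∘ toℕ) ⟨
  ∑ {suc m} (g ∘ toℕ)                              ∎
  where open ≡-Reasoning

module Search {n : ℕ} (G : Graph n) {k : ℕ} (nd : NeighbourhoodDiversity G k) where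

  R M : ℕ
  R = 3 + k * k
  M = R ^ k

  γ : Vec ℕ 4
  γ = n ∷ k ∷ R ∷ M ∷ []

  open Classes G nd
  open Semantics (adjacencyMatrix G) γ
  open Meaning G nd (k ∷ R ∷ M ∷ [])

  -- For `d < R`, `(i + 1) R ≤ d + R e` holds exactly when `i < e`; as `e ≤ M`, the loop meets all
  -- such `i`.
  ⟦div⟧ : ∀ {m} {ρ : Vec ℕ m} q d e → lookup ρ q ≡ d + R * e → d < R → e ≤ M →
    Computes (divᵉ q) ρ e
  ⟦div⟧ q d e eq d<R e≤M = ⟦≡⟧ (count-below M e e≤M)
    (⟦sum⟧ gM _ λ i a → ⟦not⟧ (toℕ i <? e) (by (below (toℕ i)) (above (toℕ i))
      (not? (lt? (⟦var⟧ eq) (⟦+⟧ (⟦mul⟧ gR λ _ _ → ⟦var⟧ refl) (computes refl))))))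
    where
    open ≤-Reasoning
    below : ∀ i → ¬ (d + R * e < R * i + R) → i < e
    below i ≮ = ≰⇒> λ e≤i → ≮ (begin-strict
      d + R * e  <⟨ +-monoˡ-< (R * e) d<R ⟩
      R + R * e  ≤⟨ +-monoʳ-≤ R (*-monoʳ-≤ R e≤i) ⟩
      R + R * i  ≡⟨ +-comm R _ ⟩
      R * i + R  ∎)
    above : ∀ i → i < e → ¬ (d + R * e < R * i + R)
    above i i<e = ≤⇒≯ (begin
      R * i + R  ≡⟨ +-comm _ R ⟩
      R + R * i  ≡⟨ *-suc R i ⟨
      R * suc i  ≤⟨ *-monoʳ-≤ R i<e ⟩
      R * e      ≤⟨ m≤n+m _ d ⟩
      d + R * e  ∎)

  r : ℕ → ℕ
  r u = ⟦ repᵉ zero ⟧ (adjacencyMatrix G) γ (u ∷ [])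

  module Encoding (digit : ℕ → ℕ) (digit<R : ∀ u → digit u < R) where

    -- Horner's scheme in base `R` over the least vertices below `u`. The newest one takes the
    -- lowest place, so a division by `R` undoes its step.
    enc : ℕ → ℕ
    enc zero    = 0
    enc (suc u) = cond (r u) (digit u + R * enc u) (enc u)

    classes : ℕ → ℕ
    classes zero    = 0
    classes (suc u) = cond (r u) 1 0 + classes u

    enc-bound : ∀ u → enc u < R ^ classes u
    enc-bound zero = z<s
    enc-bound (suc u) with r u
    ... | zero  = enc-bound u
    ... | suc _ = begin-strict
      digit u + R * enc u    <⟨ +-monoˡ-< (R * enc u) (digit<R u) ⟩
      R + R * enc u          ≡⟨ *-suc R (enc u) ⟨
      R * suc (enc u)        ≤⟨ *-monoʳ-≤ R (enc-bound u) ⟩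
      R * R ^ classes u      ∎
      where open ≤-Reasoning

    classes≡k : classes n ≡ k
    classes≡k = begin
      classes n
        ≡⟨ ∑-toℕ {λ u → cond (r u) 1 0} {classes} refl (λ _ → refl) n ⟩
      ∑ {n} (λ i → cond (r (toℕ i)) 1 0)
        ≡⟨ sum-cong-≗ (λ i → cond-dec (test (rep? {ρ = toℕ i ∷ []} zero i refl)) (rep (cl i) Fin.≟ i)) ⟩
      ∑ (λ i → 𝟙 (does (rep (cl i) Fin.≟ i)))
        ≡⟨ ∑-rep (λ _ → 1) ⟩
      ∑ {k} (λ _ → 1)
        ≡⟨ trans (∑-const k 1) (*-identityʳ k) ⟩
      k ∎
      where open ≡-Reasoning

    enc<M : enc n < M
    enc<M = subst (λ c → enc n < R ^ c) classes≡k (enc-bound n)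

    enc-step : ∀ u → enc u ≤ enc (suc u)
    enc-step u with r u
    ... | zero  = ≤-refl
    ... | suc _ = ≤-trans (m≤n*m (enc u) R) (m≤n+m _ (digit u))

    enc-mono : ∀ {u v} → u ≤′ v → enc u ≤ enc v
    enc-mono ≤′-refl               = ≤-refl
    enc-mono {v = suc v} (≤′-step u≤v) = ≤-trans (enc-mono u≤v) (enc-step v)

    -- The loop of `divᵉ` runs `M` times, so every intermediate quotient has to stay within `M`.
    enc≤M : ∀ {u} → u ≤ n → enc u ≤ M
    enc≤M u≤n = ≤-trans (enc-mono (≤⇒≤′ u≤n)) (<⇒≤ enc<M)

    -- The loop descends from `n - 1`: above `v` each round undoes one step of `enc`, from `v` down
    -- it idles. The result is `enc (suc v)`, in which the digit of `v` is still the lowest.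
    unwind : ∀ {step : ℕ → ℕ → ℕ} v → (∀ u q → u ≤ v → step u q ≡ q) →
      (∀ u → v < u → u < n → step u (enc (suc u)) ≡ enc u) →
      ∀ m → v < m → m ≤ n → fold↓ m step (enc m) ≡ enc (suc v)
    unwind {step} v idle active (suc m) v≤m m<n with m≤n⇒m<n∨m≡n (s≤s⁻¹ v≤m)
    ... | inj₁ v<m  = trans (cong (fold↓ m step) (active m v<m m<n))
                            (unwind v idle active m v<m (<⇒≤ m<n))
    ... | inj₂ refl = still (suc v) _ ≤-refl
      where
      still : ∀ m q → m ≤ suc v → fold↓ m step q ≡ q
      still zero    q _    = refl
      still (suc m) q m≤v = trans (cong (fold↓ m step) (idle m q (s≤s⁻¹ m≤v))) (still m q (<⇒≤ m≤v))

    module _ {m} {ρ : Vec ℕ m} (t v : Fin m) (i : Fin n)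
             (eₜ : lookup ρ t ≡ enc n) (eᵥ : lookup ρ v ≡ toℕ i) where

      step : ℕ → ℕ → ℕ
      step u q = ⟦ condᵉ (andᵉ (var idx ∸ᵉ var (↑ v)) (repᵉ idx)) (divᵉ acc) (var acc) ⟧
        (adjacencyMatrix G) γ (u ∷ q ∷ ρ)

      ⟦quot⟧ : Computes (quotᵉ t v) ρ (enc (suc (toℕ i)))
      ⟦quot⟧ = computes (trans (cong (fold↓ n step) eₜ)
        (unwind (toℕ i) idle active n (Fin.toℕ<n i) ≤-refl))
        where
        off : ∀ x w d q → x ≡ 0 → cond (cond x w 0) d q ≡ q
        off _ w d q refl = refl
        idle : ∀ u q → u ≤ toℕ i → step u q ≡ q
        idle u q u≤ = off (u ∸ lookup ρ v) _ _ q (trans (cong (u ∸_) eᵥ) (m≤n⇒m∸n≡0 u≤))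
        -- `w` governs both the loop test and the step of `enc`, so the quotient `d` is asked to be
        -- right only where `enc` really added a digit.
        on : ∀ x w d a b → x ≢ 0 → (cond w a b ≡ a → d ≡ b) → cond (cond x w 0) d (cond w a b) ≡ b
        on zero    w       d a b ≢ eq = contradiction refl ≢
        on (suc x) zero    d a b ≢ eq = refl
        on (suc x) (suc w) d a b ≢ eq = eq refl
        active : ∀ u → toℕ i < u → u < n → step u (enc (suc u)) ≡ enc u
        active u i<u u<n = on (u ∸ lookup ρ v) (r u) _ (digit u + R * enc u) (enc u)
          (subst (λ z → u ∸ z ≢ 0) (sym eᵥ) (m>n⇒m∸n≢0 i<u))
          λ eq → value (⟦div⟧ {ρ = u ∷ enc (suc u) ∷ ρ} acc (digit u) (enc u) eq (digit<R u) (enc≤M (<⇒≤ u<n)))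

    ⟦digit⟧ : ∀ {m} {ρ : Vec ℕ m} t v c → lookup ρ t ≡ enc n → lookup ρ v ≡ toℕ (rep c) →
      Computes (digitᵉ t v) ρ (digit (toℕ (rep c)))
    ⟦digit⟧ t v c eₜ eᵥ = ⟦≡⟧ (m+n∸n≡m (digit u) (R * enc u))
      (⟦let⟧ (⟦≡⟧ top (⟦quot⟧ t v (rep c) eₜ eᵥ))
        (⟦let⟧ (⟦div⟧ zero (digit u) (enc u) refl (digit<R u) (enc≤M (<⇒≤ (Fin.toℕ<n (rep c)))))
          (⟦∸⟧ (⟦var⟧ refl) (⟦mul⟧ gR λ _ _ → ⟦var⟧ refl))))
      where
      u = toℕ (rep c)
      on : ∀ {x P a b} → Tests x P → P → cond x a b ≡ a
      on (holds _)  _ = refl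
      on (fails ¬p) p = contradiction p ¬p
      top : enc (suc u) ≡ digit u + R * enc u
      top = on (test (rep? {ρ = u ∷ []} zero (rep c) refl)) (cong rep (cl-rep c))

  -- Read off by the expression itself, so every number `t` yields a candidate. Soundness rests on
  -- `kept≤size` for all `t`, completeness on `⟦digit⟧` for encoded ones.
  digitOf : ℕ → Fin k → ℕ
  digitOf t c = ⟦ digitᵉ zero (suc zero) ⟧ (adjacencyMatrix G) γ (t ∷ toℕ (rep c) ∷ [])

  kept : ℕ → Fin k → ℕ
  kept t c = decode (digitOf t c) (size c)

  size≢0 : ∀ c → 1 ≤ size c
  size≢0 c = subst (λ d → 1 ≤ size d) (cl-rep c)
    (n≢0⇒n>0 (X≢0 (λ _ → true) {rep c} refl))

  kept≤size : ∀ t c → kept t c ≤ size c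
  kept≤size t c with digitOf t c
  ... | 0           = z≤n
  ... | 1           = size≢0 c
  ... | suc (suc j) = m∸n≤m (size c) j

  module _ {m} {ρ : Vec ℕ m} where

    ⟦kept⟧ : ∀ t u x c → lookup ρ t ≡ x → lookup ρ u ≡ toℕ (rep c) →
      Computes (keptᵉ t u) ρ (kept x c)
    ⟦kept⟧ t u x c eₜ eᵤ = ⟦let⟧ (computes {x = digitOf x c} same)
      (⟦≡⟧ (cond-decode (digitOf x c))
        (⟦cond⟧ (⟦var⟧ refl)
          (⟦cond⟧ (⟦∸⟧ (⟦var⟧ refl) ⟦con⟧)
            (⟦∸⟧ (⟦sizeRep⟧ (suc u) c eᵤ) (⟦∸⟧ (⟦var⟧ refl) ⟦con⟧)) ⟦con⟧)
          ⟦con⟧))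
      where
      same : ⟦ digitᵉ t u ⟧ (adjacencyMatrix G) γ ρ ≡ digitOf x c
      -- `digitᵉ` consults its environment only through these two variables.
      same = cong₂ (λ y z → ⟦ digitᵉ zero (suc zero) ⟧ (adjacencyMatrix G) γ (y ∷ z ∷ [])) eₜ eᵤ
      cond-decode : ∀ d → cond d (cond (d ∸ 1) (size c ∸ (d ∸ 2)) 1) 0 ≡ decode d (size c)
      cond-decode 0             = refl
      cond-decode 1             = refl
      cond-decode (suc (suc j)) = refl

  module _ {m} {ρ : Vec ℕ m} where

    ⟦degree⟧ : ∀ t u x c → lookup ρ t ≡ x → lookup ρ u ≡ toℕ (rep c) →
      Computes (degreeᵉ t u) ρ (degree A Q (kept x) c)
    ⟦degree⟧ t u x c eₜ eᵤ = ⟦∑rep⟧ _ λ c′ a →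
      ⟦if⟧ (A c c′) (link? (↑ u) idx c c′ eᵤ refl) (⟦kept⟧ (↑ t) idx x c′ eₜ refl)

    conflictᵉ? : ∀ t u v x c c′ → lookup ρ t ≡ x → lookup ρ u ≡ toℕ (rep c) →
      lookup ρ v ≡ toℕ (rep c′) → Decides (conflictᵉ t u v) ρ (Conflict A Q (kept x) c c′)
    conflictᵉ? t u v x c c′ eₜ eᵤ eᵥ =
      and? (link? u v c c′ eᵤ eᵥ) (and? (nonzero? (⟦kept⟧ t u x c eₜ eᵤ))
        (and? (nonzero? (⟦kept⟧ t v x c′ eₜ eᵥ))
          (by (decidable-stable (_ ≟ _)) (λ eq ≢ → ≢ eq)
            (not? (neq? (⟦degree⟧ t u x c eₜ eᵤ) (⟦degree⟧ t v x c′ eₜ eᵥ))))))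

  module _ {m} {ρ : Vec ℕ m} where

    valid? : ∀ t x → lookup ρ t ≡ x → Decides (validᵉ t) ρ (Valid A Q (kept x))
    valid? t x eₜ = by
      (λ ok → record
        { clique    = λ c q → ≮⇒≥ λ lt → ok (c , inj₁ (q , lt))
        ; irregular = λ c c′ a p p′ eq → ok (c , inj₂ (c′ , a , p , p′ , eq)) })
      (λ { V (c , inj₁ (q , lt)) → <⇒≱ lt (Valid.clique V c q)
         ; V (c , inj₂ (c′ , a , p , p′ , eq)) → Valid.irregular V c c′ a p p′ eq })
      (not? (existsRep? λ c a → or?
        (and? (clique?ᵉ idx c refl) (lt? ⟦con⟧ (⟦kept⟧ (↑ t) idx x c eₜ refl)))
        (existsRep? λ c′ a′ → conflictᵉ? (↑ (↑ t)) (↑ idx) idx x c c′ eₜ refl refl)))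

    ⟦removed⟧ : ∀ t x → lookup ρ t ≡ x → Computes (removedᵉ t) ρ (∑ λ c → size c ∸ kept x c)
    ⟦removed⟧ t x eₜ = ⟦∑rep⟧ _ λ c a →
      ⟦∸⟧ (⟦sizeRep⟧ idx c refl) (⟦kept⟧ (↑ t) idx x c eₜ refl)

  -- A budget rather than an exact cost makes this upward closed, as `count-least` requires.
  Reaches : ℕ → Set
  Reaches b = ∃[ t ] Valid A Q (kept (toℕ {M} t)) × ∑ (λ c → size c ∸ kept (toℕ t) c) ≤ b

  -- Normalising the counts of `S` deletes no more vertices, and the resulting digits fit into one
  -- number below `M`.
  reaches : ∀ S → VertexIrregulator G S → Reaches ∣ S ∣
  reaches S I =
    fromℕ< enc<M , valid-cong same′ V , subst (_≤ ∣ S ∣) (sum-cong-≗ λ c → cong (size c ∸_) (same′ c))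
      (≤-trans (∑-mono λ c → ∸-monoʳ-≤ (size c) (X≤Z c)) (≤-reflexive eq))
    where
    from  = irregulator⇒valid S I
    eq    = proj₂ (proj₂ (proj₂ from))
    norm  = normalise A Q size (proj₁ from) (proj₁ (proj₂ from)) (proj₁ (proj₂ (proj₂ from)))
    Z     = proj₁ norm
    V     = proj₁ (proj₂ norm)
    X≤Z   = proj₁ (proj₂ (proj₂ norm))
    coded = proj₂ (proj₂ (proj₂ norm))

    digit : ℕ → ℕ
    digit u with u <? n
    ... | yes u<n = proj₁ (coded (cl (fromℕ< u<n)))
    ... | no _    = 0

    digit<R : ∀ u → digit u < R
    digit<R u with u <? n
    ... | yes u<n = proj₁ (proj₂ (coded (cl (fromℕ< u<n))))
    ... | no _    = z<s

    digit-rep : ∀ c → digit (toℕ (rep c)) ≡ proj₁ (coded c)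
    digit-rep c with toℕ (rep c) <? n
    ... | yes p = cong (λ d → proj₁ (coded d)) (trans (cong cl (Fin.fromℕ<-toℕ (rep c) p)) (cl-rep c))
    ... | no ≮  = contradiction (Fin.toℕ<n (rep c)) ≮

    open Encoding digit digit<R

    same : ∀ c → Z c ≡ kept (enc n) c
    same c = trans (proj₂ (proj₂ (coded c))) (cong (λ d → decode d (size c)) (sym
      (trans (value (⟦digit⟧ {ρ = enc n ∷ toℕ (rep c) ∷ []} zero (suc zero) c refl refl)) (digit-rep c))))

    same′ : ∀ c → Z c ≡ kept (toℕ (fromℕ< enc<M)) c
    same′ c = trans (same c) (cong (λ t → kept t c) (sym (Fin.toℕ-fromℕ< enc<M)))

  reaches? : ∀ {m} {ρ : Vec ℕ m} x b → lookup ρ x ≡ b →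
    Decides (sumᵉ gM (andᵉ (validᵉ idx) (notᵉ (removedᵉ idx ∸ᵉ var (↑ x))))) ρ (Reaches b)
  reaches? x b e = exists? gM λ t a → and? (valid? idx (toℕ t) refl)
    (by ≮⇒≥ ≤⇒≯ (not? (lt? (⟦var⟧ e) (⟦removed⟧ idx (toℕ t) refl))))

  abstract
    Reaches? : ∀ b → Dec (Reaches b)
    Reaches? b = decision (reaches? {ρ = b ∷ []} zero b refl)

  -- The empty graph is locally irregular, so the minimum is at most `n` and it suffices to count
  -- budgets below `n`.
  all-removed : Reaches n
  all-removed = subst Reaches (∣⊤∣≡n n)
    (reaches ⊤ λ u v u∈ _ _ _ → contradiction ∈⊤ (x∈∁p⇒x∉p u∈))

  optimum : ℕ
  optimum = ∑ {n} λ b → 𝟙 (does (¬? (Reaches? (toℕ b))))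

  optimum-least : Reaches optimum × (∀ b → Reaches b → optimum ≤ b)
  optimum-least = count-least n Reaches? (λ a≤b (t , V , le) → t , V , ≤-trans le a≤b) all-removed

  ⟦minimum⟧ : Computes minimumᵉ [] optimum
  ⟦minimum⟧ = ⟦sum⟧ gn (λ b → 𝟙 (does (¬? (Reaches? (toℕ b))))) λ b a →
    ⟦not⟧ (¬? (Reaches? (toℕ b))) (not? (reaches? idx (toℕ b) refl))

  optimum-min : MinVertexIrregulator G optimum
  optimum-min = attained (proj₁ optimum-least) , λ S I → proj₂ optimum-least ∣ S ∣ (reaches S I)
    where
    attained : Reaches optimum → ∃[ S ] VertexIrregulator G S × ∣ S ∣ ≡ optimum
    attained (t , V , le) =
      let S , I , eq = valid⇒irregulator (kept (toℕ t)) V (kept≤size (toℕ t))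
      -- The candidate certifies at most `optimum` deletions; conversely `S` itself reaches `∣ S ∣`,
      -- which minimality compares with `optimum`.
      in  S , I , ≤-antisym (≤-trans (≤-reflexive eq) le) (proj₂ optimum-least ∣ S ∣ (reaches S I))

-- The program, its time bound and the computable factor

search : Script
search = (gk , classesᵉ) ∷ (gR , radixᵉ gk) ∷ (gM , powerᵉ gR gk) ∷ (gn , minimumᵉ) ∷ []

-- Globals not yet assigned are 0, so the last stage has the largest sum.
search-outcome : ∀ {μ n K R M m} → let open Semantics μ in
  Computes (n ∷ 0 ∷ 0 ∷ 0 ∷ []) classesᵉ [] K →
  Computes (n ∷ K ∷ 0 ∷ 0 ∷ []) (radixᵉ gk) [] R →
  Computes (n ∷ K ∷ R ∷ 0 ∷ []) (powerᵉ gR gk) [] M →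
  Computes (n ∷ K ∷ R ∷ M ∷ []) minimumᵉ [] m →
  lookup (⟪ search ⟫ μ (n ∷ 0 ∷ 0 ∷ 0 ∷ [])) gn ≡ m ×
  peak search μ (n ∷ 0 ∷ 0 ∷ 0 ∷ []) ≤ n + (K + (R + (M + 0)))
search-outcome {n = n} {K} {R} {M}
  (Semantics.computes refl) (Semantics.computes refl) (Semantics.computes refl) (Semantics.computes refl) =
  refl ,
  ⊔-lub (+-monoʳ-≤ n z≤n) (⊔-lub (+-monoʳ-≤ n (+-monoʳ-≤ K z≤n))
    (⊔-lub (+-monoʳ-≤ n (+-monoʳ-≤ K (+-monoʳ-≤ R z≤n))) (⊔-lub ≤-refl z≤n)))

-- The final globals are `n`, `k`, `R` and `M`; the summand 1 pays for `n` after multiplication by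
-- `1 ⊔ n`.
bound : ℕ → ℕ
bound k = 1 + (k + (3 + k * k + (3 + k * k) ^ k))

-- Here `gn` starts with the parameter. `gk` receives `bound k`, and `gR` is reused for `D` and `C`,
-- since powers and products loop over globals.
bounding : ℕ → ℕ → Script
bounding C D =
  (gR , radixᵉ gn) ∷ (gM , powerᵉ gR gn) ∷
  (gk , con 1 +ᵉ (glob gn +ᵉ (glob gR +ᵉ glob gM))) ∷
  (gR , con D) ∷ (gM , powerᵉ gk gR) ∷
  (gR , con C) ∷ (gn , sumᵉ gR (glob gM)) ∷ []

bounding-outcome : ∀ {C D μ k R M P f} → let open Semantics μ in
  Computes (k ∷ 0 ∷ 0 ∷ 0 ∷ []) (radixᵉ gn) [] R →
  Computes (k ∷ 0 ∷ R ∷ 0 ∷ []) (powerᵉ gR gn) [] M →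
  Computes (k ∷ 1 + (k + (R + M)) ∷ D ∷ M ∷ []) (powerᵉ gk gR) [] P →
  Computes (k ∷ 1 + (k + (R + M)) ∷ C ∷ P ∷ []) (sumᵉ gR (glob gM)) [] f →
  lookup (⟪ bounding C D ⟫ μ (k ∷ 0 ∷ 0 ∷ 0 ∷ [])) gn ≡ f
bounding-outcome
  (Semantics.computes refl) (Semantics.computes refl) (Semantics.computes refl) (Semantics.computes refl) =
  refl

initial : ∀ {v} g → ((λ _ → 0) [ 0 ↦ v ]) (toℕ g) ≡ lookup (v ∷ 0 ∷ 0 ∷ 0 ∷ []) g
initial zero                   = refl
initial (suc zero)             = refl
initial (suc (suc zero))       = refl
initial (suc (suc (suc zero))) = refl

computable-bound : ∀ C D → Computable (λ k → C * bound k ^ D)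
computable-bound C D = compileScript (bounding C D) , λ k →
  let t , returns , _ =
        runScript (bounding C D) (λ _ → 0) (k ∷ 0 ∷ 0 ∷ 0 ∷ []) {natInput k} initial refl
  in  t , subst (λ v → compileScript (bounding C D) / natInput k Returns v inTime t)
        (bounding-outcome {C} {D} (⟦radix⟧ _ gn) (⟦power⟧ _ gR gn) (⟦power⟧ _ gk gR)
          (⟦mul⟧ _ gR λ _ _ → computes refl)) returns
  where open Semantics (λ _ → 0)

^-distribʳ-* : ∀ e a b → (a * b) ^ e ≡ a ^ e * b ^ e
^-distribʳ-* zero    a b = refl
^-distribʳ-* (suc e) a b =
  trans (cong (a * b *_) (^-distribʳ-* e a b)) ([m*n]*[o*p]≡[m*o]*[n*p] a b (a ^ e) (b ^ e))

peak≤ : ∀ n k R M → n + (k + (R + (M + 0))) ≤ (1 + (k + (R + M))) * (1 ⊔ n)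
peak≤ n k R M = begin
  n + (k + (R + (M + 0)))            ≡⟨ cong (λ z → n + (k + (R + z))) (+-identityʳ M) ⟩
  n + (k + (R + M))                  ≤⟨ +-mono-≤ (m≤n⊔m 1 n) (m≤m*n (k + (R + M)) (1 ⊔ n)) ⟩
  (1 ⊔ n) + (k + (R + M)) * (1 ⊔ n)  ∎
  where
  open ≤-Reasoning
  instance _ = >-nonZero (m≤m⊔n 1 n)

-- The time is at most `C` times the `D`-th power of `bound k * (1 ⊔ n)`, and this power splits into
-- a factor in `k` and a factor in `n`.
fixedParameterTractable : (l : Script) →
  (∀ n (G : Graph n) k → NeighbourhoodDiversity G k → ∃[ m ]
    MinVertexIrregulator G m ×
    lookup (⟪ l ⟫ (adjacencyMatrix G) (n ∷ 0 ∷ 0 ∷ 0 ∷ [])) gn ≡ m ×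
    peak l (adjacencyMatrix G) (n ∷ 0 ∷ 0 ∷ 0 ∷ []) ≤ bound k * (1 ⊔ n)) →
  Σ[ p ∈ Program ] Σ[ f ∈ (ℕ → ℕ) ] Σ[ c ∈ ℕ ]
    Computable f ×
    (∀ (n : ℕ) (G : Graph n) (k : ℕ) → NeighbourhoodDiversity G k →
    ∃[ m ] ∃[ t ]
    MinVertexIrregulator G m ×
    (p / graphInput G Returns m inTime t) ×
    t ≤ f k * (1 ⊔ n) ^ c)
fixedParameterTractable l spec =
  let C , D , time≤ = scriptTime-poly l
  in  compileScript l , (λ k → C * bound k ^ D) , D , computable-bound C D , λ n G k nd →
    let m , min , outcome , peak≤B = spec n G k nd
        t , returns , t≤ =
          runScript l (adjacencyMatrix G) (n ∷ 0 ∷ 0 ∷ 0 ∷ []) {graphInput G} initial refl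
        instance _ = m*n≢0 (bound k) (1 ⊔ n) {{_}} {{>-nonZero (m≤m⊔n 1 n)}}
    in  m , t , min
      , subst (λ v → compileScript l / graphInput G Returns v inTime t) outcome returns
      , (begin
          t                                ≤⟨ t≤ ⟩
          _                                ≤⟨ time≤ _ _ (bound k * (1 ⊔ n)) peak≤B ⟩
          C * (bound k * (1 ⊔ n)) ^ D      ≡⟨ cong (C *_) (^-distribʳ-* D (bound k) (1 ⊔ n)) ⟩
          C * (bound k ^ D * (1 ⊔ n) ^ D)  ≡⟨ *-assoc C _ _ ⟨
          C * bound k ^ D * (1 ⊔ n) ^ D    ∎)
  where open ≤-Reasoning

search-correct : ∀ n (G : Graph n) k → NeighbourhoodDiversity G k → ∃[ m ]
  MinVertexIrregulator G m ×
  lookup (⟪ search ⟫ (adjacencyMatrix G) (n ∷ 0 ∷ 0 ∷ 0 ∷ [])) gn ≡ m ×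
  peak search (adjacencyMatrix G) (n ∷ 0 ∷ 0 ∷ 0 ∷ []) ≤ bound k * (1 ⊔ n)
search-correct n G k nd =
  let outcome , peak≤B = search-outcome
        (Meaning.⟦classes⟧ G nd (0 ∷ 0 ∷ 0 ∷ [])) (⟦radix⟧ _ gk) (⟦power⟧ _ gR gk)
        (Search.⟦minimum⟧ G nd)
  in  Search.optimum G nd , Search.optimum-min G nd , outcome
    , ≤-trans peak≤B (peak≤ n k (3 + k * k) ((3 + k * k) ^ k))
  where open Semantics (adjacencyMatrix G)

theorem1 : Σ[ p ∈ Program ] Σ[ f ∈ (ℕ → ℕ) ] Σ[ c ∈ ℕ ]
    Computable f ×
    (∀ (n : ℕ) (G : Graph n) (k : ℕ) → NeighbourhoodDiversity G k →
    ∃[ m ] ∃[ t ]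
    MinVertexIrregulator G m ×
    (p / graphInput G Returns m inTime t) ×
    t ≤ f k * (1 ⊔ n) ^ c)
theorem1 = fixedParameterTractable search search-correct
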